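{- Let $n$ be a positive integer, let $\mathcal{Y}\subset Fl(\mathbb{C}^n)$ be the Peterson variety of type $A_{n-1}$, and let $x_1,\ldots,x_n\in H^2(\mathcal{Y};\mathbb{Q})$ be the (negatives of the) first Chern classes of the tautological line bundles. Let $s\ge 0$, let $1\le a\le c\le b\le n-1$ and $1\le l_1<l_2<\cdots<l_s<a-1$ be integers, and let $M\subseteq\{b+2,\ldots,n-1\}$. Then the following equality holds in $H^*(\mathcal{Y};\mathbb{Q})$: $$x_{l_1}\cdots x_{l_s}\,x_a\cdots x_{c-1}x_c^2x_{c+1}\cdots x_b\,x_M=(-1)^{c-a-1}\sum_{i=c}^b\binom{i-a}{c-a}e_{i-a+1}^{(l_1,\ldots,l_s)}(x_1,\ldots,x_{i-1})\,x_i\cdots x_b\,x_M+(-1)^{c-a}\sum_{i=c}^b\binom{i-a}{c-a}e_{i-a+1}^{(l_1,\ldots,l_s)}(x_1,\ldots,x_{i-1})\,x_{i+1}\cdots x_{b+1}\,x_M+x_{l_1}\cdots x_{l_s}\,x_a\cdots x_{b+1}\,x_M,$$ where $x_M=\prod_{j\in M}x_j$ and $e_{k}^{(l_1,\ldots,l_s)}$ is the polynomial defined in the context.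
   Context: $Fl(\mathbb{C}^n)$ is the variety of full flags $V_\bullet=(0=V_0\subset V_1\subset\cdots\subset V_n=\mathbb{C}^n)$, $\dim_{\mathbb{C}}V_i=i$. Let $N$ be the $n\times n$ nilpotent matrix consisting of a single Jordan block. The Peterson variety is $\mathcal{Y}=\{V_\bullet\in Fl(\mathbb{C}^n)\mid NV_i\subset V_{i+1}\ (1\le i\le n-1)\}$. Let $U_i$ be the tautological rank-$i$ vector bundle over $Fl(\mathbb{C}^n)$ (fiber $V_i$ over $V_\bullet$), and let $x_i\in H^2(\mathcal{Y};\mathbb{Q})$ be the restriction to $\mathcal{Y}$ of $-c_1(U_i/U_{i-1})$, $1\le i\le n$. Standing identification (known, due to Fukukawa–Harada–Masuda): $H^*(\mathcal{Y};\mathbb{Q})\cong\mathbb{Q}[x_1,\ldots,x_n]/J_x$, with $x_i$ corresponding to the class $x_i$, where $J_x$ is the ideal generated by $(x_1+\cdots+x_k)(x_k-x_{k+1})$ for $1\le k\le n-1$ and $x_1+\cdots+x_n$. $e_k$ denotes the $k$-th elementary symmetric polynomial in the listed variables, with $e_0=1$ (also for an empty list of variables) and $e_k=0$ when $k$ exceeds the number of variables. Empty products equal $1$. For $k\ge 0$ and $1\le l_1<\cdots<l_s\le m\le n-1$ (only the range $l_s+k\le m$ is used here), set $$e_k^{(l_1,\ldots,l_s)}(x_1,\ldots,x_m)=\sum_{0\le j_1\le j_2\le\cdots\le j_s\le k}\left(\prod_{t=0}^{s-1}e_{j_{t+1}-j_t}(x_{d_t+1},\ldots,x_{d_{t+1}-1})\,x_{d_{t+1}}\right)e_{k-j_s}(x_{d_s+1},\ldots,x_m),$$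 where $d_t=l_t+j_t$ and $l_0=j_0=0$ (so $d_0=0$). For $s=0$ this is $e_k^{\emptyset}(x_1,\ldots,x_m)=e_k(x_1,\ldots,x_m)$. -}

module Defs where

open import Algebra.Bundles using (CommutativeRing; Semiring)
open import Data.Fin.Base using (Fin; toℕ; fromℕ<; inject₁)
import Data.Fin.Base as Fin
open import Data.Fin.Subset using (Subset)
open import Data.Fin.Subset.Properties using (_∈?_)
open import Data.Integer.Base as ℤ using (ℤ)
open import Data.List.Base as List using (List; []; _∷_; _++_)
open import Data.Nat.Base as ℕ using (ℕ; zero; suc; _∸_; _≤_)
open import Data.Nat.Combinatorics using (_C_)
open import Data.Nat.Properties using (_<?_)
open import Data.Product.Base using (_,_)
open import Data.Rational.Base as ℚ using (ℚ; 0ℚ; 1ℚ)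
open import Data.Vec.Base as Vec using (Vec; []; _∷_)
open import Level using (Level; 0ℓ; _⊔_)
open import Relation.Nullary using (yes; no)
open import Relation.Unary using (Pred)
import Algebra.Definitions.RawSemiring as RawSemiringDefinitions
import Algebra.Properties.AbelianGroup as AbelianGroupProperties
import Algebra.Properties.CommutativeSemigroup as CommutativeSemigroupProperties
import Algebra.Properties.Ring as RingProperties
import Relation.Binary.Reasoning.Setoid as SetoidReasoning

-- ℚ[x₁,…,xₙ] as the free commutative ℚ-algebra on n generators: polynomial
-- expressions modulo the congruence _≈ₚ_ generated by the commutative ring
-- axioms and by con being a ring homomorphism.  The generator x_{i+1} is var i.

infixl 6 _⊕_
infixl 7 _⊗_
infix  8 ⊝_

data Poly (n : ℕ) : Set where
  con : ℚ → Poly n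
  var : Fin n → Poly n
  _⊕_ : Poly n → Poly n → Poly n
  _⊗_ : Poly n → Poly n → Poly n
  ⊝_  : Poly n → Poly n

infix 4 _≈ₚ_

data _≈ₚ_ {n : ℕ} : Poly n → Poly n → Set where
  ≈-refl  : ∀ {p} → p ≈ₚ p
  ≈-sym   : ∀ {p q} → p ≈ₚ q → q ≈ₚ p
  ≈-trans : ∀ {p q r} → p ≈ₚ q → q ≈ₚ r → p ≈ₚ r

  ⊕-cong : ∀ {p p′ q q′} → p ≈ₚ p′ → q ≈ₚ q′ → p ⊕ q ≈ₚ p′ ⊕ q′
  ⊗-cong : ∀ {p p′ q q′} → p ≈ₚ p′ → q ≈ₚ q′ → p ⊗ q ≈ₚ p′ ⊗ q′
  ⊝-cong : ∀ {p p′} → p ≈ₚ p′ → ⊝ p ≈ₚ ⊝ p′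

  ⊕-assoc     : ∀ p q r → (p ⊕ q) ⊕ r ≈ₚ p ⊕ (q ⊕ r)
  ⊕-comm      : ∀ p q → p ⊕ q ≈ₚ q ⊕ p
  ⊕-identityˡ : ∀ p → con 0ℚ ⊕ p ≈ₚ p
  ⊝-inverseˡ  : ∀ p → ⊝ p ⊕ p ≈ₚ con 0ℚ
  ⊗-assoc     : ∀ p q r → (p ⊗ q) ⊗ r ≈ₚ p ⊗ (q ⊗ r)
  ⊗-comm      : ∀ p q → p ⊗ q ≈ₚ q ⊗ p
  ⊗-identityˡ : ∀ p → con 1ℚ ⊗ p ≈ₚ p
  distribˡ    : ∀ p q r → p ⊗ (q ⊕ r) ≈ₚ p ⊗ q ⊕ p ⊗ r

  con-⊕ : ∀ a b → con (a ℚ.+ b) ≈ₚ con a ⊕ con b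
  con-⊗ : ∀ a b → con (a ℚ.* b) ≈ₚ con a ⊗ con b

polyRing : ℕ → CommutativeRing 0ℓ 0ℓ
polyRing n = record
  { Carrier = Poly n
  ; _≈_ = _≈ₚ_
  ; _+_ = _⊕_
  ; _*_ = _⊗_
  ; -_  = ⊝_
  ; 0#  = con 0ℚ
  ; 1#  = con 1ℚ
  ; isCommutativeRing = record
    { isRing = record
      { +-isAbelianGroup = record
        { isGroup = record
          { isMonoid = record
            { isSemigroup = record
              { isMagma = record
                { isEquivalence = record { refl = ≈-refl ; sym = ≈-sym ; trans = ≈-trans }
                ; ∙-cong = ⊕-cong
                }
              ; assoc = ⊕-assoc
              }
            ; identity = ⊕-identityˡ , λ p → ≈-trans (⊕-comm p _) (⊕-identityˡ p)
            }
          ; inverse = ⊝-inverseˡ , λ p → ≈-trans (⊕-comm p _) (⊝-inverseˡ p)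
          ; ⁻¹-cong = ⊝-cong
          }
        ; comm = ⊕-comm
        }
      ; *-cong = ⊗-cong
      ; *-assoc = ⊗-assoc
      ; *-identity = ⊗-identityˡ , λ p → ≈-trans (⊗-comm p _) (⊗-identityˡ p)
      ; distrib = distribˡ , λ p q r → ≈-trans (⊗-comm (q ⊕ r) p)
                    (≈-trans (distribˡ p q r) (⊕-cong (⊗-comm p q) (⊗-comm p r)))
      }
    ; *-comm = ⊗-comm
    }
  }

module _ {c ℓ : Level} (R : CommutativeRing c ℓ) where
  open CommutativeRing R

  data Ideal {g : Level} (G : Pred Carrier g) : Pred Carrier (c ⊔ ℓ ⊔ g) where
    gen  : ∀ {p} → G p → Ideal G p
    0∈   : Ideal G 0#
    +∈   : ∀ {p q} → Ideal G p → Ideal G q → Ideal G (p + q)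
    *∈   : ∀ r {p} → Ideal G p → Ideal G (r * p)
    resp : ∀ {p q} → p ≈ q → Ideal G p → Ideal G q

  -- The quotient by the ideal generated by G: same carrier and operations,
  -- with p and q identified when p - q lies in the ideal.
  module _ {g : Level} (G : Pred Carrier g) where
    open RingProperties ring using (-1*x≈-x; -‿distribʳ-*)
    open AbelianGroupProperties +-abelianGroup
      using (⁻¹-∙-comm; ⁻¹-anti-homo‿-)
    open CommutativeSemigroupProperties +-commutativeSemigroup using (interchange)
    open SetoidReasoning setoid

    private
      -∈ : ∀ {p} → Ideal G p → Ideal G (- p)
      -∈ h = resp (-1*x≈-x _) (*∈ (- 1#) h)

      ≈⇒∼ : ∀ {p q} → p ≈ q → Ideal G (p - q)
      ≈⇒∼ {p} {q} p≈q = resp (sym (trans (+-congʳ p≈q) (-‿inverseʳ q))) 0∈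

      ∼-sym : ∀ {p q} → Ideal G (p - q) → Ideal G (q - p)
      ∼-sym {p} {q} h = resp (⁻¹-anti-homo‿- p q) (-∈ h)

      telescope : ∀ p q r → (p - q) + (q - r) ≈ p - r
      telescope p q r = begin
        (p - q) + (q - r)    ≈⟨ +-assoc p (- q) (q - r) ⟩
        p + (- q + (q - r))  ≈⟨ +-congˡ (+-assoc (- q) q (- r)) ⟨
        p + (- q + q - r)    ≈⟨ +-congˡ (+-congʳ (-‿inverseˡ q)) ⟩
        p + (0# - r)         ≈⟨ +-congˡ (+-identityˡ (- r)) ⟩
        p - r                ∎

      ∼-trans : ∀ {p q r} → Ideal G (p - q) → Ideal G (q - r) → Ideal G (p - r)
      ∼-trans {p} {q} {r} h k = resp (telescope p q r) (+∈ h k)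

      ∼-+-cong : ∀ {p p′ q q′} → Ideal G (p - p′) → Ideal G (q - q′) →
                 Ideal G ((p + q) - (p′ + q′))
      ∼-+-cong {p} {p′} {q} {q′} h k = resp
        (trans (interchange p (- p′) q (- q′)) (+-congˡ (⁻¹-∙-comm p′ q′)))
        (+∈ h k)

      ∼-neg-cong : ∀ {p p′} → Ideal G (p - p′) → Ideal G (- p - - p′)
      ∼-neg-cong {p} {p′} h = resp (sym (⁻¹-∙-comm p (- p′))) (-∈ h)

      ∼-*-congˡ : ∀ r {p p′} → Ideal G (p - p′) → Ideal G (r * p - r * p′)
      ∼-*-congˡ r {p} {p′} h = resp
        (trans (CommutativeRing.distribˡ R r p (- p′)) (+-congˡ (sym (-‿distribʳ-* r p′))))
        (*∈ r h)

      ∼-*-cong : ∀ {p p′ q q′} → Ideal G (p - p′) → Ideal G (q - q′) →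
                 Ideal G (p * q - p′ * q′)
      ∼-*-cong {p} {p′} {q} {q′} h k = ∼-trans
        (∼-trans (≈⇒∼ (*-comm p q)) (∼-trans (∼-*-congˡ q h) (≈⇒∼ (*-comm q p′))))
        (∼-*-congˡ p′ k)

    quotientRing : CommutativeRing c (c ⊔ ℓ ⊔ g)
    quotientRing = record
      { Carrier = Carrier
      ; _≈_ = λ p q → Ideal G (p - q)
      ; _+_ = _+_
      ; _*_ = _*_
      ; -_  = -_
      ; 0#  = 0#
      ; 1#  = 1#
      ; isCommutativeRing = record
        { isRing = record
          { +-isAbelianGroup = record
            { isGroup = record
              { isMonoid = record
                { isSemigroup = record
                  { isMagma = record
                    { isEquivalence = record { refl = ≈⇒∼ refl ; sym = ∼-sym ; trans = ∼-trans }
                    ; ∙-cong = ∼-+-cong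
                    }
                  ; assoc = λ p q r → ≈⇒∼ (+-assoc p q r)
                  }
                ; identity = (λ p → ≈⇒∼ (+-identityˡ p)) , λ p → ≈⇒∼ (+-identityʳ p)
                }
              ; inverse = (λ p → ≈⇒∼ (-‿inverseˡ p)) , λ p → ≈⇒∼ (-‿inverseʳ p)
              ; ⁻¹-cong = ∼-neg-cong
              }
            ; comm = λ p q → ≈⇒∼ (+-comm p q)
            }
          ; *-cong = ∼-*-cong
          ; *-assoc = λ p q r → ≈⇒∼ (*-assoc p q r)
          ; *-identity = (λ p → ≈⇒∼ (*-identityˡ p)) , λ p → ≈⇒∼ (*-identityʳ p)
          ; distrib = (λ p q r → ≈⇒∼ (CommutativeRing.distribˡ R p q r)) , λ p q r → ≈⇒∼ (distribʳ p q r)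
          }
        ; *-comm = λ p q → ≈⇒∼ (*-comm p q)
        }
      }

-- The integers a, a+1, …, b in increasing order; empty when b < a.
[_⋯_] : ℕ → ℕ → List ℕ
[ a ⋯ b ] = List.map (a ℕ.+_) (List.upTo (suc b ∸ a))

-- The sublists of length k, one for each choice of k positions.
combinations : ∀ {a} {A : Set a} → ℕ → List A → List (List A)
combinations zero    ys       = [] ∷ []
combinations (suc k) []       = []
combinations (suc k) (y ∷ ys) =
  List.map (y ∷_) (combinations k ys) ++ combinations (suc k) ys

-- All (j₁,…,jₛ) with lo ≤ j₁ ≤ j₂ ≤ ⋯ ≤ jₛ ≤ hi.
weaklyIncreasing : ∀ s → ℕ → ℕ → List (Vec ℕ s)
weaklyIncreasing zero    lo hi = [] ∷ []
weaklyIncreasing (suc s) lo hi =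
  List.concatMap (λ j → List.map (j ∷_) (weaklyIncreasing s j hi)) [ lo ⋯ hi ]

module Peterson (n : ℕ) where
  open CommutativeRing (polyRing n) using (Carrier; 0#; 1#; _+_; _*_; _-_; -_; semiring)
  open RawSemiringDefinitions (Semiring.rawSemiring semiring) using (_^_; _×_)

  ∑ ∏ : List Carrier → Carrier
  ∑ = List.foldr _+_ 0#
  ∏ = List.foldr _*_ 1#

  -- The 1-based variables x₁,…,xₙ; an index outside 1,…,n gives 0.
  x : ℕ → Carrier
  x zero    = 0#
  x (suc i) with i <? n
  ... | yes i<n = var (fromℕ< i<n)
  ... | no  _   = 0#

  x[_⋯_] : ℕ → ℕ → List Carrier
  x[ a ⋯ b ] = List.map x [ a ⋯ b ]

  data J-generator : Pred Carrier 0ℓ where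
    quadratic : ∀ k → 1 ≤ k → k ≤ n ∸ 1 →
                J-generator (∑ x[ 1 ⋯ k ] * (x k - x (suc k)))
    linear    : J-generator (∑ x[ 1 ⋯ n ])

  -- H*(𝒴;ℚ), through the Fukukawa–Harada–Masuda presentation ℚ[x₁,…,xₙ]/Jₓ.
  H* : CommutativeRing 0ℓ 0ℓ
  H* = quotientRing (polyRing n) J-generator

  -- An element j of M stands for the integer toℕ j itself, so Subset n is the
  -- set of subsets of {0,…,n-1}; there is no shift by one as there is for var.
  x-set : Subset n → Carrier
  x-set M = ∏ (List.map (λ j → x (toℕ j)) (List.filter (_∈? M) (List.allFin n)))

  e : ℕ → List Carrier → Carrier
  e k ys = ∑ (List.map ∏ (combinations k ys))

  -- The summand of e_k^{(l₁,…,lₛ)}(x₁,…,x_m) at (j₁,…,jₛ).  Here j t and d t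
  -- are indexed by t = 0,…,s, with j₀ = 0 and d₀ = l₀ + j₀ = 0.
  summand : ∀ {s} → Vec ℕ s → ℕ → ℕ → Vec ℕ s → Carrier
  summand {s} l k m js =
    ∏ (List.map
         (λ t → e (j (Fin.suc t) ∸ j (inject₁ t))
                  x[ d (inject₁ t) ℕ.+ 1 ⋯ d (Fin.suc t) ∸ 1 ]
                * x (d (Fin.suc t)))
         (List.allFin s))
    * e (k ∸ j (Fin.fromℕ s)) x[ d (Fin.fromℕ s) ℕ.+ 1 ⋯ m ]
    where
      j d : Fin (suc s) → ℕ
      j t = Vec.lookup (0 ∷ js) t
      d t = Vec.lookup (0 ∷ l) t ℕ.+ j t

  -- e⟨ l ⟩ k m is e_k^{(l₁,…,lₛ)}(x₁,…,x_m).
  e⟨_⟩ : ∀ {s} → Vec ℕ s → ℕ → ℕ → Carrier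
  e⟨_⟩ {s} l k m = ∑ (List.map (summand l k m) (weaklyIncreasing s 0 k))

  binom : ℕ → ℕ → Carrier
  binom p q = (p C q) × 1#

  -- (-1)^z for an integer z, which depends only on ∣ z ∣.
  [-1]^_ : ℤ → Carrier
  [-1]^ z = (- 1#) ^ ℤ.∣ z ∣

{-# OPTIONS --safe #-}

-- Write p_l = x₁ + ⋯ + x_l.  The quadratic relations give j e_j(x₁,…,x_l) = e_{j-1}(x₁,…,x_{l-1}) p_l,
-- so over ℚ multiplication by e_j(x₁,…,x_l), j ≥ 1, identifies x_{l-j+1},…,x_{l+1}.
--
-- Consequently e_k^{(l₁,…,lₛ)}(x₁,…,x_m) = x_{l₁}⋯x_{lₛ} e_k(x₁,…,x_m): in the summand at (j₁,…,jₛ) every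
-- x_{l_t+j_t} may be replaced by x_{l_t}, and the remaining sum runs over all k-subsets S of {1,…,m},
-- sorted by the l_t-th elements d_t of the complement of S.  The factors x_{l₁}⋯x_{lₛ} and x_M are then
-- common to all terms, and what remains is the case s = 0, M = ∅.
--
-- That case is an induction on b starting from the empty case b = c - 1.  Its step says that
--   x_a⋯x_b + (-1)^{c-a} Σ_{i=c}^b C(i-a,c-a) e_{i-a+1}(x₁,…,x_{i-1}) x_{i+1}⋯x_b
-- is annihilated by D = x_{b+1} - x_b.  Since D annihilates e_j(x₁,…,x_b) for j ≥ 1, the products
-- z_k = D e_k(x₁,…,x_{a+k-2}) x_{a+k}⋯x_b satisfy z_k = x_a (z′_k - z′_{k-1}), with z′ formed for a + 1,
-- and Pascal's rule turns this into an induction on b - a.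

module Submission where

open import Defs
open import Algebra.Bundles using (CommutativeRing; Semiring)
open import Data.Fin.Base as Fin using (Fin; toℕ; fromℕ; inject₁)
open import Data.Fin.Subset using (Subset; _∈_)
open import Data.Integer.Base as ℤ using (1ℤ)
import Data.Integer.Properties as ℤₚ
open import Data.List.Base as List using (List; []; _∷_; _++_; _∷ʳ_; map; foldr; applyUpTo; upTo)
open import Data.List.Properties using (applyUpTo-∷ʳ; length-applyUpTo; map-++; map-cong; map-tabulate; map-upTo; map-∘)
open import Data.Nat.Base as ℕ using (ℕ; zero; suc; _∸_; _≤_; _<_; z≤n; s≤s)
open import Data.Nat.Combinatorics using (_C_; nCk+nC[k+1]≡[n+1]C[k+1]; k>n⇒nCk≡0)
import Data.Nat.Properties as ℕₚ
open import Data.Product.Base using (_,_)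
open import Data.Rational.Base as ℚ using (ℚ; 0ℚ; 1ℚ)
import Data.Rational.Properties as ℚₚ
open import Data.Sum.Base using (inj₁; inj₂)
open import Data.Vec.Base as Vec using (Vec; []; _∷_; toList)
open import Data.Vec.Relation.Unary.All as All using (All; []; _∷_)
open import Data.Vec.Relation.Unary.Linked using (Linked; _∷_)
open import Level using (Level)
open import Relation.Binary.PropositionalEquality as ≡ using (_≡_)
import Algebra.Definitions.RawSemiring as RawSemiringDefinitions
import Algebra.Properties.Monoid.Mult as MonoidMult
import Algebra.Properties.Ring as RingProperties
import Algebra.Solver.Ring.NaturalCoefficients.Default as NaturalCoefficientsSolver
import Relation.Binary.Reasoning.Setoid as SetoidReasoning

-- Lists of consecutive variables.

module Interval {a : Level} {A : Set a} (x : ℕ → A) where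
  open ≡.≡-Reasoning

  -- With the left end excluded, the length is `m ∸ d`, the adjacent intervals `V d k` and `V k m`
  -- share an index, and x₁,...,x_m is `V 0 m`.
  V : ℕ → ℕ → List A
  V d m = map x [ suc d ⋯ m ]

  V≡applyUpTo : ∀ d m → V d m ≡ applyUpTo (λ i → x (suc (d ℕ.+ i))) (m ∸ d)
  V≡applyUpTo d m = ≡.trans (≡.sym (map-∘ (upTo (m ∸ d)))) (map-upTo _ (m ∸ d))

  length-V : ∀ d m → List.length (V d m) ≡ m ∸ d
  length-V d m = ≡.trans (≡.cong List.length (V≡applyUpTo d m)) (length-applyUpTo _ (m ∸ d))

  V-empty : ∀ {d m} → m ≤ d → V d m ≡ []
  V-empty {d} {m} m≤d rewrite ℕₚ.m≤n⇒m∸n≡0 m≤d = ≡.refl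

  V-first : ∀ {d m} → d < m → V d m ≡ x (suc d) ∷ V (suc d) m
  -- The rewrites turn `m ∸ d` into `suc (m ∸ suc d)`, so that `upTo` exposes its first entry.
  V-first {d} {m} d<m rewrite ≡.sym (ℕₚ.suc-pred (m ∸ d) ⦃ ℕ.>-nonZero (ℕₚ.m<n⇒0<n∸m d<m) ⦄)
                            | ℕₚ.pred[m∸n]≡m∸[1+n] m d = ≡.cong₂ _∷_
    (≡.cong (λ i → x (suc i)) (ℕₚ.+-identityʳ d))
    (begin
      map x (map (suc d ℕ.+_) (applyUpTo suc k))   ≡⟨ ≡.cong (λ is → map x (map (suc d ℕ.+_) is)) (map-upTo suc k) ⟨
      map x (map (suc d ℕ.+_) (map suc (upTo k)))  ≡⟨ ≡.cong (map x) (map-∘ (upTo k)) ⟨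
      map x (map (λ i → suc d ℕ.+ suc i) (upTo k)) ≡⟨ ≡.cong (map x) (map-cong (λ i → ≡.cong suc (ℕₚ.+-suc d i)) (upTo k)) ⟩
      map x (map (suc (suc d) ℕ.+_) (upTo k))      ∎)
    where
      k = m ∸ suc d

  V-last : ∀ {d m} → d ≤ m → V d (suc m) ≡ V d m ∷ʳ x (suc m)
  V-last {d} {m} d≤m = begin
    V d (suc m)                                        ≡⟨ V≡applyUpTo d (suc m) ⟩
    applyUpTo f (suc m ∸ d)                            ≡⟨ ≡.cong (applyUpTo f) (ℕₚ.+-∸-assoc 1 d≤m) ⟩
    applyUpTo f (suc (m ∸ d))                          ≡⟨ applyUpTo-∷ʳ f (m ∸ d) ⟨
    applyUpTo f (m ∸ d) ∷ʳ x (suc (d ℕ.+ (m ∸ d)))     ≡⟨ ≡.cong₂ (λ ys i → ys ∷ʳ x (suc i))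
                                                            (≡.sym (V≡applyUpTo d m)) (ℕₚ.m+[n∸m]≡n d≤m) ⟩
    V d m ∷ʳ x (suc m)                                 ∎
    where
      f = λ i → x (suc (d ℕ.+ i))

-- Signs, finite sums and elementary symmetric polynomials in a commutative ring.

module SumsAndProducts {ρ ℓ : Level} (R : CommutativeRing ρ ℓ) where
  open CommutativeRing R renaming (distribˡ to *-distribˡ-+)
  open RawSemiringDefinitions (Semiring.rawSemiring semiring) using (_^_; _×_)
  open RingProperties ring using (-1*x≈-x)
  open MonoidMult +-monoid using (×-homo-+)
  open NaturalCoefficientsSolver commutativeSemiring using (solve; _:=_; _:+_; _:*_)
  open SetoidReasoning setoid

  ∑ ∏ : List Carrier → Carrier
  ∑ = foldr _+_ 0#
  ∏ = foldr _*_ 1#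

  e : ℕ → List Carrier → Carrier
  e k ys = ∑ (map ∏ (combinations k ys))

  -- The semiring solver has no negation. Signs are therefore multiplications by `σ`, which the
  -- solver treats as a variable, and cancellation is done by hand with the next lemmas.
  σ : Carrier
  σ = - 1#

  σ*u+u≈0 : ∀ u → σ * u + u ≈ 0#
  σ*u+u≈0 u = trans (+-congʳ (-1*x≈-x u)) (-‿inverseˡ u)

  cancel-σ : ∀ u v → σ * u + (u + v) ≈ v
  cancel-σ u v = begin
    σ * u + (u + v)  ≈⟨ +-assoc _ _ _ ⟨
    σ * u + u + v    ≈⟨ +-congʳ (σ*u+u≈0 u) ⟩
    0# + v           ≈⟨ +-identityˡ v ⟩
    v                ∎

  σ*σ*u≈u : ∀ u → σ * (σ * u) ≈ u
  σ*σ*u≈u u = begin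
    σ * (σ * u)                      ≈⟨ +-identityʳ _ ⟨
    σ * (σ * u) + 0#                 ≈⟨ +-congˡ (σ*u+u≈0 u) ⟨
    σ * (σ * u) + (σ * u + u)        ≈⟨ cancel-σ (σ * u) u ⟩
    u                                ∎

  σ^r*σ^r*u≈u : ∀ r u → σ ^ r * (σ ^ r * u) ≈ u
  σ^r*σ^r*u≈u zero    u = trans (*-identityˡ _) (*-identityˡ u)
  σ^r*σ^r*u≈u (suc r) u = begin
    σ * σ ^ r * (σ * σ ^ r * u)    ≈⟨ solve 3 (λ s p u → s :* p :* (s :* p :* u) := s :* (s :* (p :* (p :* u)))) refl σ (σ ^ r) u ⟩
    σ * (σ * (σ ^ r * (σ ^ r * u)))  ≈⟨ σ*σ*u≈u _ ⟩
    σ ^ r * (σ ^ r * u)              ≈⟨ σ^r*σ^r*u≈u r u ⟩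
    u                                ∎

  ∑-++ : ∀ ys zs → ∑ (ys ++ zs) ≈ ∑ ys + ∑ zs
  ∑-++ []       zs = sym (+-identityˡ _)
  ∑-++ (y ∷ ys) zs = trans (+-congˡ (∑-++ ys zs)) (sym (+-assoc _ _ _))

  ∏-++ : ∀ ys zs → ∏ (ys ++ zs) ≈ ∏ ys * ∏ zs
  ∏-++ []       zs = sym (*-identityˡ _)
  ∏-++ (y ∷ ys) zs = trans (*-congˡ (∏-++ ys zs)) (sym (*-assoc _ _ _))

  ∑-map-cong : ∀ {a} {A : Set a} {f g : A → Carrier} → (∀ y → f y ≈ g y) →
               ∀ ys → ∑ (map f ys) ≈ ∑ (map g ys)
  ∑-map-cong f≈g []       = refl
  ∑-map-cong f≈g (y ∷ ys) = +-cong (f≈g y) (∑-map-cong f≈g ys)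

  ∑-map-*ˡ : ∀ {a} {A : Set a} u (f : A → Carrier) ys →
             ∑ (map (λ y → u * f y) ys) ≈ u * ∑ (map f ys)
  ∑-map-*ˡ u f []       = sym (zeroʳ u)
  ∑-map-*ˡ u f (y ∷ ys) = trans (+-congˡ (∑-map-*ˡ u f ys)) (sym (*-distribˡ-+ _ _ _))

  ∑-map-concatMap : ∀ {a b} {A : Set a} {B : Set b} (f : B → Carrier) (g : A → List B) ys →
                    ∑ (map f (List.concatMap g ys)) ≈ ∑ (map (λ y → ∑ (map f (g y))) ys)
  ∑-map-concatMap f g []       = refl
  ∑-map-concatMap f g (y ∷ ys) = begin
    ∑ (map f (g y ++ List.concatMap g ys))            ≡⟨ ≡.cong ∑ (map-++ f (g y) _) ⟩
    ∑ (map f (g y) ++ map f (List.concatMap g ys))    ≈⟨ ∑-++ (map f (g y)) _ ⟩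
    ∑ (map f (g y)) + ∑ (map f (List.concatMap g ys)) ≈⟨ +-congˡ (∑-map-concatMap f g ys) ⟩
    _                                                 ∎

  e₀ : ∀ ys → e 0 ys ≈ 1#
  e₀ ys = +-identityʳ 1#

  e-∷ : ∀ k y ys → e (suc k) (y ∷ ys) ≈ y * e k ys + e (suc k) ys
  e-∷ k y ys = begin
    ∑ (map ∏ (map (y ∷_) Cₖ ++ Cₖ₊₁))                     ≡⟨ ≡.cong ∑ (map-++ ∏ (map (y ∷_) Cₖ) Cₖ₊₁) ⟩
    ∑ (map ∏ (map (y ∷_) Cₖ) ++ map ∏ Cₖ₊₁)               ≈⟨ ∑-++ (map ∏ (map (y ∷_) Cₖ)) _ ⟩
    ∑ (map ∏ (map (y ∷_) Cₖ)) + e (suc k) ys              ≡⟨ ≡.cong (λ zs → ∑ zs + _) (map-∘ Cₖ) ⟨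
    ∑ (map (λ zs → y * ∏ zs) Cₖ) + e (suc k) ys           ≈⟨ +-congʳ (∑-map-*ˡ y ∏ Cₖ) ⟩
    y * e k ys + e (suc k) ys                             ∎
    where
      Cₖ   = combinations k ys
      Cₖ₊₁ = combinations (suc k) ys

  -- `combinations` peels entries off the front, whereas the inductions below lengthen intervals at
  -- the back.
  e-∷ʳ : ∀ k ys y → e (suc k) (ys ∷ʳ y) ≈ e (suc k) ys + y * e k ys
  e-∷ʳ zero    []       y = trans (e-∷ 0 y []) (+-comm _ _)
  e-∷ʳ (suc k) []       y = trans (e-∷ (suc k) y []) (+-comm _ _)
  e-∷ʳ zero    (z ∷ ys) y = begin
    e 1 (z ∷ ys ∷ʳ y)                  ≈⟨ e-∷ 0 z (ys ∷ʳ y) ⟩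
    z * e 0 ys + e 1 (ys ∷ʳ y)         ≈⟨ +-congˡ (e-∷ʳ 0 ys y) ⟩
    z * e 0 ys + (e 1 ys + y * e 0 ys) ≈⟨ +-assoc _ _ _ ⟨
    z * e 0 ys + e 1 ys + y * e 0 ys   ≈⟨ +-congʳ (e-∷ 0 z ys) ⟨
    e 1 (z ∷ ys) + y * e 0 ys          ∎
  e-∷ʳ (suc k) (z ∷ ys) y = begin
    e (2 ℕ.+ k) (z ∷ ys ∷ʳ y)
      ≈⟨ e-∷ (suc k) z (ys ∷ʳ y) ⟩
    z * e (suc k) (ys ∷ʳ y) + e (2 ℕ.+ k) (ys ∷ʳ y)
      ≈⟨ +-cong (*-congˡ (e-∷ʳ k ys y)) (e-∷ʳ (suc k) ys y) ⟩
    z * (e (suc k) ys + y * e k ys) + (e (2 ℕ.+ k) ys + y * e (suc k) ys)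
      ≈⟨ solve 5 (λ z y a b c → z :* (a :+ y :* b) :+ (c :+ y :* a)
                             := (z :* a :+ c) :+ y :* (z :* b :+ a)) refl z y _ _ _ ⟩
    (z * e (suc k) ys + e (2 ℕ.+ k) ys) + y * (z * e k ys + e (suc k) ys)
      ≈⟨ +-cong (e-∷ (suc k) z ys) (*-congˡ (e-∷ k z ys)) ⟨
    e (2 ℕ.+ k) (z ∷ ys) + y * e (suc k) (z ∷ ys) ∎

  e-vanishes : ∀ k ys → List.length ys < k → e k ys ≈ 0#
  e-vanishes (suc k) []       _         = refl
  e-vanishes (suc k) (y ∷ ys) (s≤s p) = begin
    e (suc k) (y ∷ ys)        ≈⟨ e-∷ k y ys ⟩
    y * e k ys + e (suc k) ys ≈⟨ +-cong (*-congˡ (e-vanishes k ys p)) (e-vanishes (suc k) ys (ℕₚ.m<n⇒m<1+n p)) ⟩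
    y * 0# + 0#               ≈⟨ trans (+-identityʳ _) (zeroʳ y) ⟩
    0#                        ∎

  ∑< : ℕ → (ℕ → Carrier) → Carrier
  ∑< t f = ∑ (applyUpTo f t)

  ∑<-cong : ∀ t {f g} → (∀ i → i < t → f i ≈ g i) → ∑< t f ≈ ∑< t g
  ∑<-cong zero    f≈g = refl
  ∑<-cong (suc t) f≈g = +-cong (f≈g 0 (s≤s z≤n)) (∑<-cong t (λ i i<t → f≈g (suc i) (s≤s i<t)))

  ∑<-last : ∀ t f → ∑< (suc t) f ≈ ∑< t f + f t
  ∑<-last zero    f = +-comm _ _
  ∑<-last (suc t) f = trans (+-congˡ (∑<-last t (λ i → f (suc i)))) (sym (+-assoc _ _ _))

  ∑<-+ : ∀ t f g → ∑< t (λ i → f i + g i) ≈ ∑< t f + ∑< t g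
  ∑<-+ zero    f g = sym (+-identityˡ 0#)
  ∑<-+ (suc t) f g = trans (+-congˡ (∑<-+ t _ _))
    (solve 4 (λ a b c d → (a :+ b) :+ (c :+ d) := (a :+ c) :+ (b :+ d)) refl _ _ _ _)

  ∑<-*ˡ : ∀ t u f → ∑< t (λ i → u * f i) ≈ u * ∑< t f
  ∑<-*ˡ zero    u f = sym (zeroʳ u)
  ∑<-*ˡ (suc t) u f = trans (+-congˡ (∑<-*ˡ t u _)) (sym (*-distribˡ-+ _ _ _))

  ∑<-0 : ∀ t {f} → (∀ i → i < t → f i ≈ 0#) → ∑< t f ≈ 0#
  ∑<-0 zero    f≈0 = refl
  ∑<-0 (suc t) f≈0 = trans (+-cong (f≈0 0 (s≤s z≤n)) (∑<-0 t (λ i i<t → f≈0 (suc i) (s≤s i<t)))) (+-identityˡ 0#)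

  ∑<-drop : ∀ r u f → (∀ i → i < r → f i ≈ 0#) → ∑< (r ℕ.+ u) f ≈ ∑< u (λ i → f (r ℕ.+ i))
  ∑<-drop zero    u f f≈0 = refl
  ∑<-drop (suc r) u f f≈0 =
    trans (+-cong (f≈0 0 (s≤s z≤n)) (∑<-drop r u (λ i → f (suc i)) (λ i i<r → f≈0 (suc i) (s≤s i<r)))) (+-identityˡ _)

  -- Both sides sum `h i j` over i ≤ j < t, once by rows and once by columns. The induction removes
  -- the row i = 0.
  ∑<-triangle : ∀ t (h : ℕ → ℕ → Carrier) →
    ∑< t (λ i → ∑< (t ∸ i) (λ v → h i (i ℕ.+ v))) ≈ ∑< t (λ j → ∑< (suc j) (λ i → h i j))
  ∑<-triangle zero    h = refl
  ∑<-triangle (suc t) h = begin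
    ∑< (suc t) (h 0) + ∑< t (λ i → ∑< (t ∸ i) (λ v → h (suc i) (suc (i ℕ.+ v))))
      ≈⟨ +-congˡ (∑<-triangle t (λ i j → h (suc i) (suc j))) ⟩
    ∑< (suc t) (h 0) + ∑< t (λ j → ∑< (suc j) (λ i → h (suc i) (suc j)))
      -- The added zero is the empty column j = 0, which gives both sums the same range.
      ≈⟨ +-congˡ (+-identityˡ _) ⟨
    ∑< (suc t) (h 0) + ∑< (suc t) (λ j → ∑< j (λ i → h (suc i) j))
      ≈⟨ ∑<-+ (suc t) (h 0) (λ j → ∑< j (λ i → h (suc i) j)) ⟨
    ∑< (suc t) (λ j → ∑< (suc j) (λ i → h i j)) ∎

  ∑-range : ∀ f a b → ∑ (map f [ a ⋯ b ]) ≡ ∑< (suc b ∸ a) (λ i → f (a ℕ.+ i))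
  ∑-range f a b = ≡.cong ∑ (≡.trans (≡.sym (map-∘ (upTo (suc b ∸ a)))) (map-upTo _ (suc b ∸ a)))

  e₁ : ∀ ys → e 1 ys ≈ ∑ ys
  e₁ []       = refl
  e₁ (y ∷ ys) = begin
    e 1 (y ∷ ys)         ≈⟨ e-∷ 0 y ys ⟩
    y * e 0 ys + e 1 ys  ≈⟨ +-cong (*-congˡ (e₀ ys)) (e₁ ys) ⟩
    y * 1# + ∑ ys        ≈⟨ +-congʳ (*-identityʳ y) ⟩
    y + ∑ ys             ∎

  ∑-∷ʳ : ∀ ys y → ∑ (ys ∷ʳ y) ≈ ∑ ys + y
  ∑-∷ʳ ys y = trans (∑-++ ys (y ∷ [])) (+-congˡ (+-identityʳ y))

  ∏-∷ʳ : ∀ ys y → ∏ (ys ∷ʳ y) ≈ ∏ ys * y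
  ∏-∷ʳ ys y = trans (∏-++ ys (y ∷ [])) (*-congˡ (*-identityʳ y))

  ι : ℕ → Carrier
  ι k = k × 1#

  ι-+ : ∀ j k → ι (j ℕ.+ k) ≈ ι j + ι k
  ι-+ = ×-homo-+ 1#

  -- Elementary symmetric polynomials of intervals of variables.

  module Windows (x : ℕ → Carrier) where

    open Interval x

    e-last : ∀ k {d m} → d ≤ m → e (suc k) (V d (suc m)) ≈ e (suc k) (V d m) + x (suc m) * e k (V d m)
    e-last k d≤m = trans (reflexive (≡.cong (e (suc k)) (V-last d≤m))) (e-∷ʳ k _ _)

    ∑-last : ∀ {d m} → d ≤ m → ∑ (V d (suc m)) ≈ ∑ (V d m) + x (suc m)
    ∑-last {d} {m} d≤m = trans (reflexive (≡.cong ∑ (V-last d≤m))) (∑-∷ʳ (V d m) _)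

    ∏-last : ∀ {d m} → d ≤ m → ∏ (V d (suc m)) ≈ ∏ (V d m) * x (suc m)
    ∏-last {d} {m} d≤m = trans (reflexive (≡.cong ∏ (V-last d≤m))) (∏-∷ʳ (V d m) _)

    ∏-first : ∀ {d m} → d < m → ∏ (V d m) ≈ x (suc d) * ∏ (V (suc d) m)
    ∏-first d<m = reflexive (≡.cong ∏ (V-first d<m))

    ∏-split : ∀ {d k} u → d ≤ k → ∏ (V d (k ℕ.+ u)) ≈ ∏ (V d k) * ∏ (V k (k ℕ.+ u))
    ∏-split {d} {k} zero    d≤k rewrite ℕₚ.+-identityʳ k =
      sym (trans (*-congˡ (reflexive (≡.cong ∏ (V-empty (ℕₚ.≤-refl {k}))))) (*-identityʳ _))
    ∏-split {d} {k} (suc u) d≤k rewrite ℕₚ.+-suc k u = begin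
      ∏ (V d (suc (k ℕ.+ u)))                            ≈⟨ ∏-last (ℕₚ.≤-trans d≤k (ℕₚ.m≤m+n k u)) ⟩
      ∏ (V d (k ℕ.+ u)) * x (suc (k ℕ.+ u))              ≈⟨ *-congʳ (∏-split u d≤k) ⟩
      ∏ (V d k) * ∏ (V k (k ℕ.+ u)) * x (suc (k ℕ.+ u))  ≈⟨ *-assoc _ _ _ ⟩
      ∏ (V d k) * (∏ (V k (k ℕ.+ u)) * x (suc (k ℕ.+ u))) ≈⟨ *-congˡ (∏-last (ℕₚ.m≤m+n k u)) ⟨
      ∏ (V d k) * ∏ (V k (suc (k ℕ.+ u)))                ∎

    -- For a k-subset S of {1,…,m}, the number q+1+j is the (q+1)-st element of the complement of S
    -- for exactly one j; the summand at j collects these S.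
    e-split : ∀ q k m → suc (q ℕ.+ k) ≤ m →
      ∑< (suc k) (λ j → e j (V 0 (q ℕ.+ j)) * e (k ∸ j) (V (suc (q ℕ.+ j)) m)) ≈ e k (V 0 m)
    e-split q zero    m       _    = trans (+-identityʳ _) (trans (*-cong (e₀ []) (e₀ []))
                                       (trans (*-identityˡ 1#) (sym (e₀ (V 0 m)))))
    e-split q (suc k) (suc m) (s≤s q+k+1≤m) = begin
      ∑< (2 ℕ.+ k) (λ j → A j * e (suc k ∸ j) (V (suc (q ℕ.+ j)) (suc m)))
        -- The term j = k + 1 is set apart: its second factor has degree 0, so `e-last` does not
        -- apply to it. In all other terms x_{m+1} is split off.
        ≈⟨ ∑<-last (suc k) (λ j → A j * e (suc k ∸ j) (V (suc (q ℕ.+ j)) (suc m))) ⟩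
      ∑< (suc k) (λ j → A j * e (suc k ∸ j) (V (suc (q ℕ.+ j)) (suc m)))
        + A (suc k) * e (k ∸ k) (V (suc (q ℕ.+ suc k)) (suc m))
        ≈⟨ +-cong (∑<-cong (suc k) λ { j (s≤s j≤k) → split j j≤k })
                  (trans (*-congˡ (top (V (suc (q ℕ.+ suc k)) (suc m)))) (*-identityʳ _)) ⟩
      ∑< (suc k) (λ j → A j * e (suc k ∸ j) (B j) + x (suc m) * (A j * e (k ∸ j) (B j))) + A (suc k)
        ≈⟨ +-congʳ (∑<-+ (suc k) (λ j → A j * e (suc k ∸ j) (B j)) (λ j → x (suc m) * (A j * e (k ∸ j) (B j)))) ⟩
      ∑< (suc k) (λ j → A j * e (suc k ∸ j) (B j))
        + ∑< (suc k) (λ j → x (suc m) * (A j * e (k ∸ j) (B j))) + A (suc k)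
        ≈⟨ solve 3 (λ a b c → (a :+ b) :+ c := (a :+ c) :+ b) refl _ _ _ ⟩
      ∑< (suc k) (λ j → A j * e (suc k ∸ j) (B j)) + A (suc k)
        + ∑< (suc k) (λ j → x (suc m) * (A j * e (k ∸ j) (B j)))
        ≈⟨ +-cong rest (trans (∑<-*ˡ (suc k) (x (suc m)) (λ j → A j * e (k ∸ j) (B j)))
                              (*-congˡ (e-split q k m q+k+1≤m′))) ⟩
      e (suc k) (V 0 m) + x (suc m) * e k (V 0 m)
        ≈⟨ e-last k {0} {m} z≤n ⟨
      e (suc k) (V 0 (suc m)) ∎
      where
        A : ℕ → Carrier
        A j = e j (V 0 (q ℕ.+ j))
        B : ℕ → List Carrier
        B j = V (suc (q ℕ.+ j)) m
        q+k+1≤m′ : suc (q ℕ.+ k) ≤ m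
        q+k+1≤m′ = ≡.subst (_≤ m) (ℕₚ.+-suc q k) q+k+1≤m
        top : ∀ ys → e (k ∸ k) ys ≈ 1#
        top ys = trans (reflexive (≡.cong (λ i → e i ys) (ℕₚ.n∸n≡0 k))) (e₀ ys)
        split : ∀ j → j ≤ k → A j * e (suc k ∸ j) (V (suc (q ℕ.+ j)) (suc m))
                              ≈ A j * e (suc k ∸ j) (B j) + x (suc m) * (A j * e (k ∸ j) (B j))
        split j j≤k rewrite ℕₚ.+-∸-assoc 1 j≤k =
          trans (*-congˡ (e-last (k ∸ j) (ℕₚ.≤-trans (s≤s (ℕₚ.+-monoʳ-≤ q j≤k)) q+k+1≤m′)))
                (solve 4 (λ a b c d → a :* (b :+ c :* d) := a :* b :+ c :* (a :* d)) refl _ _ _ _)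
        rest : ∑< (suc k) (λ j → A j * e (suc k ∸ j) (B j)) + A (suc k) ≈ e (suc k) (V 0 m)
        rest with ℕₚ.m≤n⇒m<n∨m≡n q+k+1≤m
        ... | inj₁ q+k+1<m = begin
          ∑< (suc k) (λ j → A j * e (suc k ∸ j) (B j)) + A (suc k)
            ≈⟨ +-congˡ (trans (*-congˡ (top (B (suc k)))) (*-identityʳ _)) ⟨
          ∑< (suc k) (λ j → A j * e (suc k ∸ j) (B j)) + A (suc k) * e (k ∸ k) (B (suc k))
            ≈⟨ ∑<-last (suc k) (λ j → A j * e (suc k ∸ j) (B j)) ⟨
          ∑< (2 ℕ.+ k) (λ j → A j * e (suc k ∸ j) (B j))
            ≈⟨ e-split q (suc k) m q+k+1<m ⟩
          e (suc k) (V 0 m) ∎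
        -- Here m = q + k + 1. Each `B j` has k - j entries, too few for degree k + 1 - j, and the
        -- remaining term `A (suc k)` is already the right-hand side.
        ... | inj₂ ≡.refl = trans (+-congʳ (∑<-0 (suc k) λ { j (s≤s j≤k) →
            trans (*-congˡ (e-vanishes (suc k ∸ j) (B j) (short j j≤k))) (zeroʳ (A j)) })) (+-identityˡ _)
          where
            short : ∀ j → j ≤ k → List.length (B j) < suc k ∸ j
            short j j≤k rewrite length-V (suc (q ℕ.+ j)) (q ℕ.+ suc k) | ℕₚ.+-suc q k
                              | ℕₚ.[m+n]∸[m+o]≡n∸o q k j | ℕₚ.+-∸-assoc 1 j≤k = ℕₚ.≤-refl

    -- The summation over j₁,…,jₛ in e_k^{(l₁,…,lₛ)}(x₁,…,x_m), with d = d₀ and j = j₀ arbitrary.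
    nested : ∀ {s} → Vec ℕ s → ℕ → ℕ → ℕ → ℕ → Carrier
    nested []       d j k m = e (k ∸ j) (V d m)
    nested (l ∷ ls) d j k m =
      ∑ (map (λ i → e (i ∸ j) (V d (l ℕ.+ i ∸ 1)) * x (l ℕ.+ i) * nested ls (l ℕ.+ i) i k m) [ j ⋯ k ])

    -- Consequences of the quadratic relations in a ring where positive integers cancel.

    module Relations
      (N : ℕ)
      (quadratic-relation : ∀ m → 1 ≤ m → m ≤ N → ∑ (V 0 m) * x m ≈ ∑ (V 0 m) * x (suc m))
      (ι-cancel : ∀ k {u v} → ι (suc k) * u ≈ ι (suc k) * v → u ≈ v)
      where

      -- Iterating: j! e_j(x₁,…,x_l) = p_{l-j+1} ⋯ p_l with p_i = x₁ + ⋯ + x_i.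
      ι*e : ∀ j l → l ≤ N → ι (suc j) * e (suc j) (V 0 (suc l)) ≈ e j (V 0 l) * ∑ (V 0 (suc l))
      ι*e zero    l       _   = begin
        ι 1 * e 1 (V 0 (suc l))          ≈⟨ *-cong (+-identityʳ 1#) (e₁ (V 0 (suc l))) ⟩
        1# * ∑ (V 0 (suc l))             ≈⟨ *-congʳ (e₀ (V 0 l)) ⟨
        e 0 (V 0 l) * ∑ (V 0 (suc l))    ∎
      ι*e (suc j) zero    _   = begin
        ι (2 ℕ.+ j) * e (2 ℕ.+ j) (V 0 1) ≈⟨ *-congˡ (e-vanishes (2 ℕ.+ j) (V 0 1) (s≤s (s≤s z≤n))) ⟩
        ι (2 ℕ.+ j) * 0#                  ≈⟨ zeroʳ (ι (2 ℕ.+ j)) ⟩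
        0#                                ≈⟨ zeroˡ (∑ (V 0 1)) ⟨
        0# * ∑ (V 0 1)                    ∎
      ι*e (suc j) (suc l) l+1≤N = begin
        (1# + ι (suc j)) * e (2 ℕ.+ j) (V 0 (2 ℕ.+ l))
          ≈⟨ *-congˡ (e-last (suc j) {0} {suc l} z≤n) ⟩
        (1# + ι (suc j)) * (E₂ + y * E₁)
          -- Of the j + 2 copies of `y * E₁`, the induction hypothesis is applied to j + 1. The
          -- remaining copy later supplies the summand x_{l+2} of p_{l+2}.
          ≈⟨ solve 5 (λ o i a y b → (o :+ i) :* (a :+ y :* b) := (o :+ i) :* a :+ (y :* (o :* b) :+ y :* (i :* b)))
               refl 1# (ι (suc j)) E₂ y E₁ ⟩
        ι (2 ℕ.+ j) * E₂ + (y * (1# * E₁) + y * (ι (suc j) * E₁))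
          ≈⟨ +-cong (ι*e (suc j) l l≤N) (+-cong (*-congˡ (*-identityˡ E₁)) (*-congˡ (ι*e j l l≤N))) ⟩
        F₁ * P + (y * E₁ + y * (F₀ * P))
          ≈⟨ solve 5 (λ f p y e g → f :* p :+ (y :* e :+ y :* (g :* p)) := (f :* p :+ g :* (p :* y)) :+ y :* e)
               refl F₁ P y E₁ F₀ ⟩
        F₁ * P + F₀ * (P * y) + y * E₁
          -- In the presence of `P` the variable x_{l+2} becomes x_{l+1}, which is what `F₁` and
          -- `F₀` need to recombine to `E₁`.
          ≈⟨ +-congʳ (+-congˡ (*-congˡ (quadratic-relation (suc l) (s≤s z≤n) l+1≤N))) ⟨
        F₁ * P + F₀ * (P * x (suc l)) + y * E₁
          ≈⟨ +-congʳ (solve 4 (λ f p g z → f :* p :+ g :* (p :* z) := (f :+ z :* g) :* p) refl F₁ P F₀ (x (suc l))) ⟩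
        (F₁ + x (suc l) * F₀) * P + y * E₁
          ≈⟨ +-cong (*-congʳ (sym (e-last j {0} {l} z≤n))) (*-comm y E₁) ⟩
        E₁ * P + E₁ * y
          ≈⟨ *-distribˡ-+ E₁ P y ⟨
        E₁ * (P + y)
          ≈⟨ *-congˡ (∑-last {0} {suc l} z≤n) ⟨
        E₁ * ∑ (V 0 (2 ℕ.+ l)) ∎
        where
          l≤N = ℕₚ.≤-trans (ℕₚ.n≤1+n l) l+1≤N
          y   = x (2 ℕ.+ l)
          P   = ∑ (V 0 (suc l))
          E₁  = e (suc j) (V 0 (suc l))
          E₂  = e (2 ℕ.+ j) (V 0 (suc l))
          F₀  = e j (V 0 l)
          F₁  = e (suc j) (V 0 l)

      -- After multiplication by j + 1 the polynomial acquires the factor p_{l+1}, on which the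
      -- quadratic relation acts directly.
      e-step : ∀ j l → suc l ≤ N →
        e (suc j) (V 0 (suc l)) * x (2 ℕ.+ l) ≈ e (suc j) (V 0 (suc l)) * x (suc l)
      e-step j l l+1≤N = ι-cancel j (begin
        ι (suc j) * (E * x (2 ℕ.+ l))  ≈⟨ *-assoc _ _ _ ⟨
        ι (suc j) * E * x (2 ℕ.+ l)    ≈⟨ *-congʳ (ι*e j l l≤N) ⟩
        F * P * x (2 ℕ.+ l)            ≈⟨ *-assoc _ _ _ ⟩
        F * (P * x (2 ℕ.+ l))          ≈⟨ *-congˡ (quadratic-relation (suc l) (s≤s z≤n) l+1≤N) ⟨
        F * (P * x (suc l))            ≈⟨ *-assoc _ _ _ ⟨
        F * P * x (suc l)              ≈⟨ *-congʳ (ι*e j l l≤N) ⟨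
        ι (suc j) * E * x (suc l)      ≈⟨ *-assoc _ _ _ ⟩
        ι (suc j) * (E * x (suc l))    ∎)
        where
          l≤N = ℕₚ.≤-trans (ℕₚ.n≤1+n l) l+1≤N
          E   = e (suc j) (V 0 (suc l))
          F   = e j (V 0 l)
          P   = ∑ (V 0 (suc l))

      -- Induction on the degree: `e-step` lowers the index of the variable by one. Then (j + 1)
      -- e_{j+1} is written as e_j p_{l+1}, and the induction hypothesis moves the variable past e_j
      -- the rest of the way.
      e-shift : ∀ j q → q ℕ.+ j ≤ N →
        e j (V 0 (q ℕ.+ j)) * x (suc (q ℕ.+ j)) ≈ e j (V 0 (q ℕ.+ j)) * x (suc q)
      e-shift zero    q _ = *-congˡ (reflexive (≡.cong (λ i → x (suc i)) (ℕₚ.+-identityʳ q)))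
      e-shift (suc j) q q+j+1≤N rewrite ℕₚ.+-suc q j = trans (e-step j l q+j+1≤N) (ι-cancel j (begin
        ι (suc j) * (E * x (suc l))  ≈⟨ *-assoc _ _ _ ⟨
        ι (suc j) * E * x (suc l)    ≈⟨ *-congʳ (ι*e j l l≤N) ⟩
        F * P * x (suc l)            ≈⟨ solve 3 (λ f p y → f :* p :* y := f :* y :* p) refl F P _ ⟩
        F * x (suc l) * P            ≈⟨ *-congʳ (e-shift j q l≤N) ⟩
        F * x (suc q) * P            ≈⟨ solve 3 (λ f p y → f :* y :* p := f :* p :* y) refl F P _ ⟩
        F * P * x (suc q)            ≈⟨ *-congʳ (ι*e j l l≤N) ⟨
        ι (suc j) * E * x (suc q)    ≈⟨ *-assoc _ _ _ ⟩
        ι (suc j) * (E * x (suc q))  ∎))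
        where
          l   = q ℕ.+ j
          l≤N = ℕₚ.≤-trans (ℕₚ.n≤1+n l) q+j+1≤N
          E   = e (suc j) (V 0 (suc l))
          F   = e j (V 0 l)
          P   = ∑ (V 0 (suc l))

      -- Induction on the number of indices. `e-shift` makes the first variable independent of j₁.
      -- Once the sums over j₁ ≤ j₂ are exchanged, `e-split` evaluates the inner one, and a sum of
      -- the same shape, beginning at the next index, is left.
      ∑-nested : ∀ {s} q (ls : Vec ℕ s) k m → Linked _<_ (suc q ∷ ls) → All (λ l → l ℕ.+ k ≤ m) (suc q ∷ ls) → m ≤ N →
        ∑< (suc k) (λ j → e j (V 0 (q ℕ.+ j)) * x (suc (q ℕ.+ j)) * nested ls (suc (q ℕ.+ j)) j k m)
          ≈ ∏ (map x (toList (suc q ∷ ls))) * e k (V 0 m)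
      ∑-nested q [] k m _ (q+k<m ∷ []) m≤N = begin
        ∑< (suc k) (λ j → e j (V 0 (q ℕ.+ j)) * x (suc (q ℕ.+ j)) * e (k ∸ j) (V (suc (q ℕ.+ j)) m))
          ≈⟨ ∑<-cong (suc k) (λ { j (s≤s j≤k) → trans (*-congʳ (e-shift j q (bound j≤k)))
               (solve 3 (λ a y b → a :* y :* b := y :* (a :* b)) refl (e j (V 0 (q ℕ.+ j))) _ (e (k ∸ j) (V (suc (q ℕ.+ j)) m))) }) ⟩
        ∑< (suc k) (λ j → x (suc q) * (e j (V 0 (q ℕ.+ j)) * e (k ∸ j) (V (suc (q ℕ.+ j)) m)))
          ≈⟨ ∑<-*ˡ (suc k) (x (suc q)) (λ j → e j (V 0 (q ℕ.+ j)) * e (k ∸ j) (V (suc (q ℕ.+ j)) m)) ⟩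
        x (suc q) * ∑< (suc k) (λ j → e j (V 0 (q ℕ.+ j)) * e (k ∸ j) (V (suc (q ℕ.+ j)) m))
          ≈⟨ *-cong (sym (*-identityʳ (x (suc q)))) (e-split q k m q+k<m) ⟩
        x (suc q) * 1# * e k (V 0 m) ∎
        where
          bound : ∀ {j} → j ≤ k → q ℕ.+ j ≤ N
          bound j≤k = ℕₚ.≤-trans (ℕₚ.+-monoʳ-≤ q j≤k) (ℕₚ.≤-trans (ℕₚ.<⇒≤ q+k<m) m≤N)
      ∑-nested q (suc q′ ∷ ls) k m (s≤s q<q′ ∷ linked) (q+k<m ∷ bounds) m≤N = begin
        ∑< (suc k) (λ j → A j * x (suc (q ℕ.+ j)) * nested (suc q′ ∷ ls) (suc (q ℕ.+ j)) j k m)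
          ≈⟨ ∑<-cong (suc k) (λ { j (s≤s j≤k) → expand j j≤k }) ⟩
        ∑< (suc k) (λ j → ∑< (suc k ∸ j) (λ v → h j (j ℕ.+ v)))
          ≈⟨ ∑<-triangle (suc k) h ⟩
        ∑< (suc k) (λ i → ∑< (suc i) (λ j → h j i))
          ≈⟨ ∑<-cong (suc k) (λ i _ → collect i) ⟩
        ∑< (suc k) (λ i → x (suc q) * (e i (V 0 (q′ ℕ.+ i)) * x (suc (q′ ℕ.+ i)) * nested ls (suc (q′ ℕ.+ i)) i k m))
          ≈⟨ ∑<-*ˡ (suc k) (x (suc q)) (λ i → e i (V 0 (q′ ℕ.+ i)) * x (suc (q′ ℕ.+ i)) * nested ls (suc (q′ ℕ.+ i)) i k m) ⟩
        x (suc q) * ∑< (suc k) (λ i → e i (V 0 (q′ ℕ.+ i)) * x (suc (q′ ℕ.+ i)) * nested ls (suc (q′ ℕ.+ i)) i k m)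
          ≈⟨ *-congˡ (∑-nested q′ ls k m linked bounds m≤N) ⟩
        x (suc q) * (∏ (map x (toList (suc q′ ∷ ls))) * e k (V 0 m))
          ≈⟨ *-assoc _ _ _ ⟨
        x (suc q) * ∏ (map x (toList (suc q′ ∷ ls))) * e k (V 0 m) ∎
        where
          A : ℕ → Carrier
          A j = e j (V 0 (q ℕ.+ j))
          B : ℕ → ℕ → Carrier
          B j i = e (i ∸ j) (V (suc (q ℕ.+ j)) (q′ ℕ.+ i))
          T : ℕ → Carrier
          T i = x (suc (q′ ℕ.+ i)) * nested ls (suc (q′ ℕ.+ i)) i k m
          g h : ℕ → ℕ → Carrier
          g j i = B j i * x (suc (q′ ℕ.+ i)) * nested ls (suc (q′ ℕ.+ i)) i k m
          h j i = x (suc q) * T i * (A j * B j i)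
          bound : ∀ {j} → j ≤ k → q ℕ.+ j ≤ N
          bound j≤k = ℕₚ.≤-trans (ℕₚ.+-monoʳ-≤ q j≤k) (ℕₚ.≤-trans (ℕₚ.<⇒≤ q+k<m) m≤N)
          expand : ∀ j → j ≤ k → A j * x (suc (q ℕ.+ j)) * nested (suc q′ ∷ ls) (suc (q ℕ.+ j)) j k m
                                 ≈ ∑< (suc k ∸ j) (λ v → h j (j ℕ.+ v))
          expand j j≤k = begin
            A j * x (suc (q ℕ.+ j)) * ∑ (map (g j) [ j ⋯ k ])
              ≈⟨ *-cong (e-shift j q (bound j≤k)) (reflexive (∑-range (g j) j k)) ⟩
            A j * x (suc q) * ∑< (suc k ∸ j) (λ v → g j (j ℕ.+ v))
              ≈⟨ ∑<-*ˡ (suc k ∸ j) (A j * x (suc q)) (λ v → g j (j ℕ.+ v)) ⟨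
            ∑< (suc k ∸ j) (λ v → A j * x (suc q) * g j (j ℕ.+ v))
              ≈⟨ ∑<-cong (suc k ∸ j) (λ v _ → solve 5 (λ a y b z f → a :* y :* (b :* z :* f) := y :* (z :* f) :* (a :* b))
                   refl (A j) (x (suc q)) (B j (j ℕ.+ v)) _ (nested ls (suc (q′ ℕ.+ (j ℕ.+ v))) (j ℕ.+ v) k m)) ⟩
            ∑< (suc k ∸ j) (λ v → h j (j ℕ.+ v)) ∎
          collect : ∀ i → ∑< (suc i) (λ j → h j i)
                          ≈ x (suc q) * (e i (V 0 (q′ ℕ.+ i)) * x (suc (q′ ℕ.+ i)) * nested ls (suc (q′ ℕ.+ i)) i k m)
          collect i = begin
            ∑< (suc i) (λ j → x (suc q) * T i * (A j * B j i))
              ≈⟨ ∑<-*ˡ (suc i) (x (suc q) * T i) (λ j → A j * B j i) ⟩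
            x (suc q) * T i * ∑< (suc i) (λ j → A j * B j i)
              -- The interval x₁,...,x_{q′+i} is long enough for `e-split` exactly because q < q′,
              -- that is, because consecutive l_t increase strictly.
              ≈⟨ *-congˡ (e-split q i (q′ ℕ.+ i) (ℕₚ.+-monoˡ-≤ i q<q′)) ⟩
            x (suc q) * T i * e i (V 0 (q′ ℕ.+ i))
              ≈⟨ solve 4 (λ y z f a → y :* (z :* f) :* a := y :* (a :* z :* f)) refl (x (suc q)) _ (nested ls (suc (q′ ℕ.+ i)) i k m) (e i (V 0 (q′ ℕ.+ i))) ⟩
            x (suc q) * (e i (V 0 (q′ ℕ.+ i)) * x (suc (q′ ℕ.+ i)) * nested ls (suc (q′ ℕ.+ i)) i k m) ∎

      -- Annihilation by the difference of two neighbouring variables.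

      module Difference (l : ℕ) (l+1≤N : suc l ≤ N) where
        m = suc l

        D : Carrier
        D = x (suc m) + σ * x m

        D*u≈0 : ∀ {u} → u * x (suc m) ≈ u * x m → D * u ≈ 0#
        D*u≈0 {u} eq = begin
          (x (suc m) + σ * x m) * u       ≈⟨ solve 4 (λ y s z u → (y :+ s :* z) :* u := s :* (u :* z) :+ u :* y) refl _ σ _ u ⟩
          σ * (u * x m) + u * x (suc m)   ≈⟨ +-congˡ eq ⟩
          σ * (u * x m) + u * x m         ≈⟨ σ*u+u≈0 (u * x m) ⟩
          0#                              ∎

        D*u≈0⇒ : ∀ {u} → D * u ≈ 0# → u * x (suc m) ≈ u * x m
        D*u≈0⇒ {u} eq = begin
          u * x (suc m)                                     ≈⟨ cancel-σ (u * x m) _ ⟨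
          σ * (u * x m) + (u * x m + u * x (suc m))         ≈⟨ solve 4 (λ y s z u → s :* (u :* z) :+ (u :* z :+ u :* y) := (y :+ s :* z) :* u :+ u :* z) refl _ σ _ u ⟩
          D * u + u * x m                                   ≈⟨ +-congʳ eq ⟩
          0# + u * x m                                      ≈⟨ +-identityˡ _ ⟩
          u * x m                                           ∎

        -- The z_k of the introduction without the factor D, for a = q + 1 and b = m. The number of
        -- variables is q + k - 1, so k = 0 is a separate clause that avoids truncated subtraction.
        z : ℕ → ℕ → Carrier
        z q zero    = ∏ (V q m)
        z q (suc k) = e (suc k) (V 0 (q ℕ.+ k)) * ∏ (V (suc (q ℕ.+ k)) m)

        -- For `suc q` the number of variables is q + k, and one formula covers both clauses.
        z-suc : ∀ q k → z (suc q) k ≈ e k (V 0 (q ℕ.+ k)) * ∏ (V (suc (q ℕ.+ k)) m)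
        z-suc q zero    rewrite ℕₚ.+-identityʳ q = sym (trans (*-congʳ (e₀ (V 0 q))) (*-identityˡ _))
        z-suc q (suc k) rewrite ℕₚ.+-suc q k = refl

        a : ℕ → ℕ → Carrier
        a q k = e (suc k) (V 0 (suc (q ℕ.+ k))) * ∏ (V (suc (q ℕ.+ k)) m)

        -- Removing the last variable of e_{k+1}(x₁,...,x_{q+k+1}) leaves a multiple of x_{q+k+1}
        -- e_k(x₁,...,x_{q+k}), where `e-shift` replaces x_{q+k+1} by x_{q+1}.
        z-split : ∀ q k → q ℕ.+ k ≤ l → z q (suc k) ≈ a q k + σ * x (suc q) * z (suc q) k
        z-split q k q+k≤l = begin
          E * Π                                     ≈⟨ cancel-σ (G * y * Π) (E * Π) ⟨
          σ * (G * y * Π) + (G * y * Π + E * Π)     ≈⟨ solve 5 (λ s g y p e → s :* (g :* y :* p) :+ (g :* y :* p :+ e :* p)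
                                                         := (e :+ y :* g) :* p :+ s :* (g :* y :* p)) refl σ G y Π E ⟩
          (E + y * G) * Π + σ * (G * y * Π)         ≈⟨ +-cong (*-congʳ (sym (e-last k {0} {q ℕ.+ k} z≤n)))
                                                              (*-congˡ (*-congʳ (e-shift k q q+k≤N))) ⟩
          a q k + σ * (G * x (suc q) * Π)           ≈⟨ +-congˡ (solve 4 (λ s g y p → s :* (g :* y :* p) := s :* y :* (g :* p))
                                                         refl σ G (x (suc q)) Π) ⟩
          a q k + σ * x (suc q) * (G * Π)           ≈⟨ +-congˡ (*-congˡ (z-suc q k)) ⟨
          a q k + σ * x (suc q) * z (suc q) k       ∎
          where
            q+k≤N = ℕₚ.≤-trans q+k≤l (ℕₚ.≤-trans (ℕₚ.n≤1+n l) l+1≤N)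
            E = e (suc k) (V 0 (q ℕ.+ k))
            G = e k (V 0 (q ℕ.+ k))
            y = x (suc (q ℕ.+ k))
            Π = ∏ (V (suc (q ℕ.+ k)) m)

        a-shift : ∀ q k → q ℕ.+ k < l → a q k ≈ x (suc q) * z (suc q) (suc k)
        a-shift q k q+k<l = begin
          E * ∏ (V (suc (q ℕ.+ k)) m)    ≈⟨ *-congˡ (∏-first (s≤s q+k<l)) ⟩
          E * (x (2 ℕ.+ (q ℕ.+ k)) * Π)  ≈⟨ *-assoc _ _ _ ⟨
          E * x (2 ℕ.+ (q ℕ.+ k)) * Π    ≈⟨ *-congʳ (≡.subst (λ i → e (suc k) (V 0 i) * x (suc i) ≈ e (suc k) (V 0 i) * x (suc q))
                                              (ℕₚ.+-suc q k) (e-shift (suc k) q bound)) ⟩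
          E * x (suc q) * Π              ≈⟨ solve 3 (λ e y p → e :* y :* p := y :* (e :* p)) refl E _ Π ⟩
          x (suc q) * (E * Π)            ∎
          where
            bound : q ℕ.+ suc k ≤ N
            bound rewrite ℕₚ.+-suc q k = ℕₚ.≤-trans q+k<l (ℕₚ.≤-trans (ℕₚ.n≤1+n l) l+1≤N)
            E = e (suc k) (V 0 (suc (q ℕ.+ k)))
            Π = ∏ (V (2 ℕ.+ (q ℕ.+ k)) m)

        D*a≈0 : ∀ q t → q ℕ.+ t ≡ l → D * a q t ≈ 0#
        D*a≈0 q t ≡.refl = begin
          D * (E * Π)  ≈⟨ *-assoc _ _ _ ⟨
          D * E * Π    ≈⟨ *-congʳ (D*u≈0 (e-step t l l+1≤N)) ⟩
          0# * Π       ≈⟨ zeroˡ Π ⟩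
          0#           ∎
          where
            E = e (suc t) (V 0 m)
            Π = ∏ (V m m)

        -- Summation by parts with z_{k+1} = x_{q+1} (z′_{k+1} - z′_k). For k = t this recursion
        -- holds only after multiplication by D, with z′_{t+1} absent; the boundary term at the
        -- other end is the multiple of z′₀.
        ∑-z-step : ∀ q t (f : ℕ → Carrier) → q ℕ.+ t ≡ l →
          D * ∑< (suc t) (λ k → f k * z q (suc k))
            ≈ x (suc q) * (D * ∑< t (λ k → (f k + σ * f (suc k)) * z (suc q) (suc k))
                           + σ * (f 0 * (D * ∏ (V (suc q) m))))
        ∑-z-step q t f q+t≡l = begin
          D * ∑< (suc t) (λ k → f k * z q (suc k))
            ≈⟨ *-congˡ (∑<-cong (suc t) λ { k (s≤s k≤t) →
                 trans (*-congˡ (z-split q k (ℕₚ.≤-trans (ℕₚ.+-monoʳ-≤ q k≤t) (ℕₚ.≤-reflexive q+t≡l))))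
                       (solve 4 (λ f a c z → f :* (a :+ c :* z) := f :* a :+ c :* (f :* z)) refl (f k) (a q k) (σ * y) (z (suc q) k)) }) ⟩
          D * ∑< (suc t) (λ k → f k * a q k + σ * y * (f k * z (suc q) k))
            ≈⟨ *-congˡ (∑<-+ (suc t) (λ k → f k * a q k) (λ k → σ * y * (f k * z (suc q) k))) ⟩
          D * (∑< (suc t) (λ k → f k * a q k) + ∑< (suc t) (λ k → σ * y * (f k * z (suc q) k)))
            ≈⟨ *-congˡ (+-cong (∑<-last t (λ k → f k * a q k)) (∑<-*ˡ (suc t) (σ * y) (λ k → f k * z (suc q) k))) ⟩
          D * (∑< t (λ k → f k * a q k) + f t * a q t + σ * y * (f 0 * Π + S₁))
            ≈⟨ *-congˡ (+-congʳ (+-congʳ (trans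
                 (∑<-cong t (λ k k<t → trans (*-congˡ (a-shift q k (ℕₚ.<-≤-trans (ℕₚ.+-monoʳ-< q k<t) (ℕₚ.≤-reflexive q+t≡l))))
                    (solve 3 (λ f y z → f :* (y :* z) := y :* (f :* z)) refl (f k) y (z (suc q) (suc k)))))
                 (∑<-*ˡ t y (λ k → f k * z (suc q) (suc k)))))) ⟩
          D * (y * S₀ + f t * a q t + σ * y * (f 0 * Π + S₁))
            ≈⟨ solve 9 (λ d y s₀ f a s g p s₁ → d :* (y :* s₀ :+ f :* a :+ s :* y :* (g :* p :+ s₁))
                         := y :* (d :* (s₀ :+ s :* s₁) :+ s :* (g :* (d :* p))) :+ f :* (d :* a))
                 refl D y S₀ (f t) (a q t) σ (f 0) Π S₁ ⟩
          y * (D * (S₀ + σ * S₁) + σ * (f 0 * (D * Π))) + f t * (D * a q t)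
            ≈⟨ +-cong (*-congˡ (+-congʳ (*-congˡ merge))) (trans (*-congˡ (D*a≈0 q t q+t≡l)) (zeroʳ (f t))) ⟩
          y * (D * ∑< t (λ k → (f k + σ * f (suc k)) * z (suc q) (suc k)) + σ * (f 0 * (D * Π))) + 0#
            ≈⟨ +-identityʳ _ ⟩
          y * (D * ∑< t (λ k → (f k + σ * f (suc k)) * z (suc q) (suc k)) + σ * (f 0 * (D * Π))) ∎
          where
            y  = x (suc q)
            Π  = ∏ (V (suc q) m)
            S₀ = ∑< t (λ k → f k * z (suc q) (suc k))
            S₁ = ∑< t (λ k → f (suc k) * z (suc q) (suc k))
            merge : S₀ + σ * S₁ ≈ ∑< t (λ k → (f k + σ * f (suc k)) * z (suc q) (suc k))
            merge = begin
              S₀ + σ * S₁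
                ≈⟨ +-congˡ (∑<-*ˡ t σ (λ k → f (suc k) * z (suc q) (suc k))) ⟨
              S₀ + ∑< t (λ k → σ * (f (suc k) * z (suc q) (suc k)))
                ≈⟨ ∑<-+ t (λ k → f k * z (suc q) (suc k)) (λ k → σ * (f (suc k) * z (suc q) (suc k))) ⟨
              ∑< t (λ k → f k * z (suc q) (suc k) + σ * (f (suc k) * z (suc q) (suc k)))
                ≈⟨ ∑<-cong t (λ k _ → solve 4 (λ f s g z → f :* z :+ s :* (g :* z) := (f :+ s :* g) :* z)
                                        refl (f k) σ (f (suc k)) (z (suc q) (suc k))) ⟩
              ∑< t (λ k → (f k + σ * f (suc k)) * z (suc q) (suc k)) ∎

        -- By Pascal's rule the differences of the coefficients C(k,r) are -C(k,r-1), so each step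
        -- lowers r and t and raises q. The boundary term carries C(0,r) and vanishes until r = 0,
        -- where the differences vanish instead and it alone remains. The bound r ≤ t lets the
        -- descent reach r = 0.
        ∑-binomial-z : ∀ r q t → r ≤ t → q ℕ.+ t ≡ l →
          D * ∑< (suc t) (λ k → ι (k C r) * z q (suc k)) ≈ σ * (σ ^ r * (D * ∏ (V q m)))
        ∑-binomial-z zero q t _ q+t≡l = begin
          D * ∑< (suc t) (λ k → ι (k C 0) * z q (suc k))
            ≈⟨ ∑-z-step q t (λ k → ι (k C 0)) q+t≡l ⟩
          y * (D * ∑< t (λ k → (ι 1 + σ * ι 1) * z (suc q) (suc k)) + σ * (ι 1 * (D * Π)))
            ≈⟨ *-congˡ (+-cong (*-congˡ (∑<-0 t λ k _ → trans (*-congʳ (trans (+-comm _ _) (σ*u+u≈0 (ι 1)))) (zeroˡ (z (suc q) (suc k)))))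
                               (*-congˡ (*-congʳ (+-identityʳ 1#)))) ⟩
          y * (D * 0# + σ * (1# * (D * Π)))
            ≈⟨ *-congˡ (trans (+-congʳ (zeroʳ D)) (+-identityˡ _)) ⟩
          y * (σ * (1# * (D * Π)))
            ≈⟨ solve 5 (λ y s o d p → y :* (s :* (o :* (d :* p))) := s :* (o :* (d :* (y :* p)))) refl y σ 1# D Π ⟩
          σ * (1# * (D * (y * Π)))
            ≈⟨ *-congˡ (*-congˡ (*-congˡ (∏-first (s≤s (ℕₚ.m+n≤o⇒m≤o q (ℕₚ.≤-reflexive q+t≡l)))))) ⟨
          σ * (1# * (D * ∏ (V q m))) ∎
          where
            y = x (suc q)
            Π = ∏ (V (suc q) m)
        ∑-binomial-z (suc r) q (suc t) (s≤s r≤t) q+t+1≡l = begin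
          D * ∑< (2 ℕ.+ t) (λ k → ι (k C suc r) * z q (suc k))
            ≈⟨ ∑-z-step q (suc t) (λ k → ι (k C suc r)) q+t+1≡l ⟩
          y * (D * ∑< (suc t) (λ k → (ι (k C suc r) + σ * ι (suc k C suc r)) * z (suc q) (suc k)) + σ * (0# * (D * Π)))
            ≈⟨ *-congˡ (+-cong (*-congˡ (∑<-cong (suc t) λ k _ → trans (*-congʳ (pascal k)) (*-assoc σ _ (z (suc q) (suc k)))))
                               (trans (*-congˡ (zeroˡ (D * Π))) (zeroʳ σ))) ⟩
          y * (D * ∑< (suc t) (λ k → σ * (ι (k C r) * z (suc q) (suc k))) + 0#)
            ≈⟨ *-congˡ (trans (+-identityʳ _) (*-congˡ (∑<-*ˡ (suc t) σ (λ k → ι (k C r) * z (suc q) (suc k))))) ⟩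
          y * (D * (σ * ∑< (suc t) (λ k → ι (k C r) * z (suc q) (suc k))))
            ≈⟨ solve 4 (λ y d s S → y :* (d :* (s :* S)) := y :* s :* (d :* S)) refl y D σ _ ⟩
          y * σ * (D * ∑< (suc t) (λ k → ι (k C r) * z (suc q) (suc k)))
            ≈⟨ *-congˡ (∑-binomial-z r (suc q) t r≤t (≡.trans (≡.sym (ℕₚ.+-suc q t)) q+t+1≡l)) ⟩
          y * σ * (σ * (σ ^ r * (D * Π)))
            ≈⟨ solve 5 (λ y s w d p → y :* s :* (s :* (w :* (d :* p))) := s :* (s :* w :* (d :* (y :* p)))) refl y σ (σ ^ r) D Π ⟩
          σ * (σ * σ ^ r * (D * (y * Π)))
            ≈⟨ *-congˡ (*-congˡ (*-congˡ (∏-first (s≤s (ℕₚ.m+n≤o⇒m≤o q (ℕₚ.≤-reflexive q+t+1≡l)))))) ⟨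
          σ * (σ * σ ^ r * (D * ∏ (V q m))) ∎
          where
            y = x (suc q)
            Π = ∏ (V (suc q) m)
            pascal : ∀ k → ι (k C suc r) + σ * ι (suc k C suc r) ≈ σ * ι (k C r)
            pascal k = begin
              ι (k C suc r) + σ * ι (suc k C suc r)
                ≡⟨ ≡.cong (λ i → ι (k C suc r) + σ * ι i) (nCk+nC[k+1]≡[n+1]C[k+1] k r) ⟨
              ι (k C suc r) + σ * ι (k C r ℕ.+ k C suc r)
                ≈⟨ +-congˡ (*-congˡ (ι-+ (k C r) (k C suc r))) ⟩
              ι (k C suc r) + σ * (ι (k C r) + ι (k C suc r))
                ≈⟨ solve 3 (λ a s b → a :+ s :* (b :+ a) := s :* a :+ (a :+ s :* b)) refl (ι (k C suc r)) σ (ι (k C r)) ⟩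
              σ * ι (k C suc r) + (ι (k C suc r) + σ * ι (k C r))
                ≈⟨ cancel-σ (ι (k C suc r)) _ ⟩
              σ * ι (k C r) ∎

        -- The sum may start at k = 0, since the added binomials vanish. The two signs `σ ^ r` then
        -- cancel, and D x_{q+1}⋯x_m meets its negative.
        D*U≈0 : ∀ q r u → q ℕ.+ (r ℕ.+ u) ≡ l →
          D * (∏ (V q m) + σ ^ r * ∑< (suc u) (λ v → ι ((r ℕ.+ v) C r) * z q (suc (r ℕ.+ v)))) ≈ 0#
        D*U≈0 q r u q+r+u≡l = begin
          D * (∏ (V q m) + σ ^ r * ∑< (suc u) (λ v → ι ((r ℕ.+ v) C r) * z q (suc (r ℕ.+ v))))
            ≈⟨ *-congˡ (+-congˡ (*-congˡ (∑<-drop r (suc u) (λ k → ι (k C r) * z q (suc k)) below))) ⟨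
          D * (∏ (V q m) + σ ^ r * ∑< (r ℕ.+ suc u) (λ k → ι (k C r) * z q (suc k)))
            ≡⟨ ≡.cong (λ t → D * (∏ (V q m) + σ ^ r * ∑< t (λ k → ι (k C r) * z q (suc k)))) (ℕₚ.+-suc r u) ⟩
          D * (∏ (V q m) + σ ^ r * ∑< (suc (r ℕ.+ u)) (λ k → ι (k C r) * z q (suc k)))
            ≈⟨ solve 4 (λ d p w S → d :* (p :+ w :* S) := w :* (d :* S) :+ d :* p) refl D (∏ (V q m)) (σ ^ r) _ ⟩
          σ ^ r * (D * ∑< (suc (r ℕ.+ u)) (λ k → ι (k C r) * z q (suc k))) + D * ∏ (V q m)
            ≈⟨ +-congʳ (*-congˡ (∑-binomial-z r q (r ℕ.+ u) (ℕₚ.m≤m+n r u) q+r+u≡l)) ⟩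
          σ ^ r * (σ * (σ ^ r * (D * ∏ (V q m)))) + D * ∏ (V q m)
            ≈⟨ +-congʳ (solve 3 (λ w s p → w :* (s :* (w :* p)) := s :* (w :* (w :* p))) refl (σ ^ r) σ _) ⟩
          σ * (σ ^ r * (σ ^ r * (D * ∏ (V q m)))) + D * ∏ (V q m)
            ≈⟨ +-congʳ (*-congˡ (σ^r*σ^r*u≈u r _)) ⟩
          σ * (D * ∏ (V q m)) + D * ∏ (V q m)
            ≈⟨ σ*u+u≈0 _ ⟩
          0# ∎
          where
            below : ∀ k → k < r → ι (k C r) * z q (suc k) ≈ 0#
            below k k<r = trans (*-congʳ (reflexive (≡.cong ι (k>n⇒nCk≡0 k<r)))) (zeroˡ (z q (suc k)))

      -- Induction on b: the identity without xₗ and x_M.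

      coeff : ℕ → ℕ → ℕ → Carrier
      coeff q r v = ι ((r ℕ.+ v) C r) * e (suc (r ℕ.+ v)) (V 0 (q ℕ.+ (r ℕ.+ v)))

      -- For a = q + 1, c = a + r, b = m and i = c + v these are the two sums of the theorem, with
      -- x_{b+1} taken out of the second. The number of terms is u = b - c + 1, so u = 0 is the
      -- empty case b = c - 1.
      Y Z : ℕ → ℕ → ℕ → ℕ → Carrier
      Y q r m u = ∑< u (λ v → coeff q r v * ∏ (V (q ℕ.+ (r ℕ.+ v)) m))
      Z q r m u = ∑< u (λ v → coeff q r v * ∏ (V (suc (q ℕ.+ (r ℕ.+ v))) m))

      -- The sum `Y` stands alone on the right so that the other side is a single multiple of
      -- x_{m+1}: the bracket annihilated by D, in which x_{m+1} may become x_m.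
      straighten : ∀ q r u m → q ℕ.+ (r ℕ.+ u) ≡ m → m ≤ N →
        (∏ (V q m) + σ ^ r * Z q r m u) * x (suc m) ≈ ∏ (V q m) * x (suc (q ℕ.+ r)) + σ ^ r * Y q r m u
      straighten q r zero m q+r+0≡m m≤N = begin
        (∏ (V q m) + σ ^ r * 0#) * x (suc m)                 ≈⟨ solve 3 (λ p w y → (p :+ w) :* y := p :* y :+ w :* y) refl _ _ _ ⟩
        ∏ (V q m) * x (suc m) + σ ^ r * 0# * x (suc m)       ≈⟨ +-cong (*-congˡ (reflexive (≡.cong (λ i → x (suc i)) m≡q+r)))
                                                                       (trans (*-congʳ (zeroʳ _)) (trans (zeroˡ _) (sym (zeroʳ _)))) ⟩
        ∏ (V q m) * x (suc (q ℕ.+ r)) + σ ^ r * 0#           ∎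
        where
          m≡q+r : m ≡ q ℕ.+ r
          m≡q+r = ≡.trans (≡.sym q+r+0≡m) (≡.cong (q ℕ.+_) (ℕₚ.+-identityʳ r))
      straighten q r (suc u) m q+r+u+1≡m m≤N
        rewrite ≡.trans (≡.sym q+r+u+1≡m) (≡.trans (≡.cong (q ℕ.+_) (ℕₚ.+-suc r u)) (ℕₚ.+-suc q (r ℕ.+ u))) = begin
        (∏ (V q (suc l)) + w * Z q r (suc l) (suc u)) * x (2 ℕ.+ l)
          -- The last variable x_{l+2} becomes x_{l+1}. Expanding the bracket then exposes the
          -- left-hand side for l, to which the induction hypothesis applies.
          ≈⟨ Difference.D*u≈0⇒ l m≤N (trans
               (*-congˡ (+-congˡ (*-congˡ (∑<-cong (suc u) (λ v _ → *-assoc (ι ((r ℕ.+ v) C r))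
                  (e (suc (r ℕ.+ v)) (V 0 (q ℕ.+ (r ℕ.+ v)))) (∏ (V (suc (q ℕ.+ (r ℕ.+ v))) (suc l))))))))
               (Difference.D*U≈0 l m≤N q r u ≡.refl)) ⟩
        (∏ (V q (suc l)) + w * Z q r (suc l) (suc u)) * y
          ≈⟨ *-congʳ (+-cong (∏-last q≤l) (*-congˡ Z-last)) ⟩
        (∏ (V q l) * y + w * (Z q r l u * y + K)) * y
          ≈⟨ solve 5 (λ p y w z k → (p :* y :+ w :* (z :* y :+ k)) :* y := (((p :+ w :* z) :* y) :+ w :* k) :* y)
               refl (∏ (V q l)) y w (Z q r l u) K ⟩
        ((∏ (V q l) + w * Z q r l u) * y + w * K) * y
          ≈⟨ *-congʳ (+-congʳ (straighten q r u l ≡.refl (ℕₚ.≤-trans (ℕₚ.n≤1+n l) m≤N))) ⟩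
        (∏ (V q l) * c + w * Y q r l u + w * K) * y
          ≈⟨ solve 6 (λ p c w z k y → (p :* c :+ w :* z :+ w :* k) :* y := (p :* y) :* c :+ w :* ((z :+ k) :* y))
               refl (∏ (V q l)) c w (Y q r l u) K y ⟩
        ∏ (V q l) * y * c + w * ((Y q r l u + K) * y)
          ≈⟨ +-cong (*-congʳ (∏-last q≤l)) (*-congˡ Y-last) ⟨
        ∏ (V q (suc l)) * c + w * Y q r (suc l) (suc u) ∎
        where
          l = q ℕ.+ (r ℕ.+ u)
          w = σ ^ r
          y = x (suc l)
          c = x (suc (q ℕ.+ r))
          K = coeff q r u
          q≤l : q ≤ l
          q≤l = ℕₚ.m≤m+n q (r ℕ.+ u)
          below : ∀ {v} → v < u → suc (q ℕ.+ (r ℕ.+ v)) ≤ l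
          below v<u = ℕₚ.+-monoʳ-< q (ℕₚ.+-monoʳ-< r v<u)
          pull : ∀ (f : ℕ → ℕ) → (∀ v → v < u → f v ≤ l) →
                 ∑< u (λ v → coeff q r v * ∏ (V (f v) (suc l))) ≈ ∑< u (λ v → coeff q r v * ∏ (V (f v) l)) * y
          pull f f≤l = begin
            ∑< u (λ v → coeff q r v * ∏ (V (f v) (suc l)))
              ≈⟨ ∑<-cong u (λ v v<u → trans (*-congˡ (∏-last (f≤l v v<u)))
                   (solve 3 (λ a b y → a :* (b :* y) := y :* (a :* b)) refl (coeff q r v) (∏ (V (f v) l)) y)) ⟩
            ∑< u (λ v → y * (coeff q r v * ∏ (V (f v) l)))
              ≈⟨ ∑<-*ˡ u y (λ v → coeff q r v * ∏ (V (f v) l)) ⟩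
            y * ∑< u (λ v → coeff q r v * ∏ (V (f v) l))
              ≈⟨ *-comm y _ ⟩
            ∑< u (λ v → coeff q r v * ∏ (V (f v) l)) * y ∎
          -- The new last term has an empty product in `Z` but the single factor `y` in `Y`, so only
          -- `Y` is a multiple of `y` as a whole.
          Z-last : Z q r (suc l) (suc u) ≈ Z q r l u * y + K
          Z-last = trans (∑<-last u (λ v → coeff q r v * ∏ (V (suc (q ℕ.+ (r ℕ.+ v))) (suc l))))
            (+-cong (pull (λ v → suc (q ℕ.+ (r ℕ.+ v))) (λ v → below))
                    (trans (*-congˡ (reflexive (≡.cong ∏ (V-empty (ℕₚ.≤-refl {suc l}))))) (*-identityʳ K)))
          Y-last : Y q r (suc l) (suc u) ≈ (Y q r l u + K) * y
          Y-last = begin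
            Y q r (suc l) (suc u)
              ≈⟨ ∑<-last u (λ v → coeff q r v * ∏ (V (q ℕ.+ (r ℕ.+ v)) (suc l))) ⟩
            Y q r (suc l) u + K * ∏ (V l (suc l))
              ≈⟨ +-cong (pull (λ v → q ℕ.+ (r ℕ.+ v)) (λ v v<u → ℕₚ.<⇒≤ (below v<u))) (*-congˡ (∏-last (ℕₚ.≤-refl {l}))) ⟩
            Y q r l u * y + K * (∏ (V l l) * y)
              ≈⟨ +-congˡ (*-congˡ (trans (*-congʳ (reflexive (≡.cong ∏ (V-empty (ℕₚ.≤-refl {l}))))) (*-identityˡ y))) ⟩
            Y q r l u * y + K * y
              ≈⟨ distribʳ y _ _ ⟨
            (Y q r l u + K) * y ∎

      -- `straighten` with `Y` moved across. Its sign `σ * σ ^ r` is (-1)^{c-a+1}, the same as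
      -- (-1)^{c-a-1}.
      square-expansion : ∀ q r u m → q ℕ.+ (r ℕ.+ u) ≡ m → m ≤ N →
        ∏ (V q m) * x (suc (q ℕ.+ r))
          ≈ σ * σ ^ r * Y q r m u + σ ^ r * (Z q r m u * x (suc m)) + ∏ (V q m) * x (suc m)
      square-expansion q r u m eq m≤N = begin
        A
          ≈⟨ cancel-σ B A ⟨
        σ * B + (B + A)
          ≈⟨ +-congˡ (trans (+-comm B A) (sym (straighten q r u m eq m≤N))) ⟩
        σ * B + (∏ (V q m) + σ ^ r * Z q r m u) * x (suc m)
          ≈⟨ solve 6 (λ s w b p z y → s :* (w :* b) :+ (p :+ w :* z) :* y := s :* w :* b :+ w :* (z :* y) :+ p :* y)
               refl σ (σ ^ r) (Y q r m u) (∏ (V q m)) (Z q r m u) (x (suc m)) ⟩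
        σ * σ ^ r * Y q r m u + σ ^ r * (Z q r m u * x (suc m)) + ∏ (V q m) * x (suc m) ∎
        where
          A = ∏ (V q m) * x (suc (q ℕ.+ r))
          B = σ ^ r * Y q r m u

-- The relations in the cohomology ring.

module Cohomology (n : ℕ) where
  open Peterson n
  open CommutativeRing H* renaming (distribˡ to *-distribˡ-+)
  open SumsAndProducts H* using (σ; σ*σ*u≈u; ι; ∑<; ∑<-cong; ∑<-*ˡ; ∑-range; ∑-map-cong; ∑-map-*ˡ; ∑-map-concatMap; module Windows)
  open Windows x using (nested; ∏-first; ∏-last; ∏-split)
  open NaturalCoefficientsSolver commutativeSemiring using (solve; _:=_; _:+_; _:*_)
  open RawSemiringDefinitions (Semiring.rawSemiring semiring) using (_^_)
  private module Polyₙ = RawSemiringDefinitions (Semiring.rawSemiring (CommutativeRing.semiring (polyRing n)))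
  open Interval x using (V)
  open SetoidReasoning setoid

  ≈ₚ⇒≈ : ∀ {p q} → p ≈ₚ q → p ≈ q
  ≈ₚ⇒≈ {p} p≈q = resp (⊕-cong ≈-refl (⊝-cong p≈q)) (refl {p})

  quadratic-relation : ∀ m → 1 ≤ m → m ≤ n ∸ 1 → ∑ (V 0 m) * x m ≈ ∑ (V 0 m) * x (suc m)
  quadratic-relation m 1≤m m≤n-1 =
    resp (≈-trans (distribˡ _ _ _) (⊕-cong ≈-refl (≈-sym (-‿distribʳ-* _ _))))
         (gen (quadratic m 1≤m m≤n-1))
    where open RingProperties (CommutativeRing.ring (polyRing n)) using (-‿distribʳ-*)

  fromℕℚ : ℕ → ℚ
  fromℕℚ zero    = 0ℚ
  fromℕℚ (suc k) = 1ℚ ℚ.+ fromℕℚ k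

  fromℕℚ-nonNegative : ∀ k → ℚ.NonNegative (fromℕℚ k)
  fromℕℚ-nonNegative zero    = _
  fromℕℚ-nonNegative (suc k) = ℚₚ.nonNeg+nonNeg⇒nonNeg 1ℚ (fromℕℚ k) ⦃ fromℕℚ-nonNegative k ⦄

  fromℕℚ-nonZero : ∀ k → ℚ.NonZero (fromℕℚ (suc k))
  fromℕℚ-nonZero k = ℚₚ.pos⇒nonZero (fromℕℚ (suc k))
    ⦃ ℚ.positive (ℚₚ.+-mono-<-≤ (ℚₚ.positive⁻¹ 1ℚ) (ℚₚ.nonNegative⁻¹ (fromℕℚ k) ⦃ fromℕℚ-nonNegative k ⦄)) ⦄

  ι≈con : ∀ k → ι k ≈ₚ con (fromℕℚ k)
  ι≈con zero    = ≈-refl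
  ι≈con (suc k) = ≈-trans (⊕-cong ≈-refl (ι≈con k)) (≈-sym (con-⊕ 1ℚ (fromℕℚ k)))

  -- Rational coefficients enter here: the constant 1/(k+1) inverts `ι (suc k)`.
  ι-cancel : ∀ k {u v} → ι (suc k) * u ≈ ι (suc k) * v → u ≈ v
  ι-cancel k {u} {v} eq = begin
    u                        ≈⟨ unit u ⟨
    inv * (ι (suc k) * u)    ≈⟨ *-congˡ {inv} eq ⟩
    inv * (ι (suc k) * v)    ≈⟨ unit v ⟩
    v                        ∎
    where
      instance _ = fromℕℚ-nonZero k
      p   = fromℕℚ (suc k)
      inv = con (ℚ.1/ p)
      unit : ∀ w → inv * (ι (suc k) * w) ≈ w
      unit w = ≈ₚ⇒≈ (≈-trans (≈-sym (⊗-assoc inv _ w)) (≈-trans (⊗-cong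
        (≈-trans (⊗-cong ≈-refl (ι≈con (suc k))) (≈-trans (≈-sym (con-⊗ (ℚ.1/ p) p))
          (≡.subst (λ a → con {n} (ℚ.1/ p ℚ.* p) ≈ₚ con a) (ℚₚ.*-inverseˡ p) ≈-refl))) ≈-refl)
        (⊗-identityˡ w)))

  open Windows.Relations x (n ∸ 1) quadratic-relation ι-cancel using (∑-nested; square-expansion; Y; Z; coeff)

  -- Factorization of e_k^{(l₁,...,lₛ)}.

  range-+1 : ∀ d m → x[ d ℕ.+ 1 ⋯ m ] ≡ V d m
  range-+1 d m rewrite ℕₚ.+-comm d 1 = ≡.refl

  factor : ∀ {s} → Vec ℕ (suc s) → Vec ℕ (suc s) → Fin s → Carrier
  factor L J t = e (j (Fin.suc t) ∸ j (inject₁ t)) x[ d (inject₁ t) ℕ.+ 1 ⋯ d (Fin.suc t) ∸ 1 ] * x (d (Fin.suc t))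
    where
      j d : Fin _ → ℕ
      j t = Vec.lookup J t
      d t = Vec.lookup L t ℕ.+ j t

  -- summand l k m js is summand⁺ (0 ∷ l) (0 ∷ js) k m; freeing l₀ and j₀ allows induction on s.
  summand⁺ : ∀ {s} → Vec ℕ (suc s) → Vec ℕ (suc s) → ℕ → ℕ → Carrier
  summand⁺ {s} L J k m = ∏ (map (factor L J) (List.allFin s))
    * e (k ∸ Vec.lookup J (fromℕ s)) x[ Vec.lookup L (fromℕ s) ℕ.+ Vec.lookup J (fromℕ s) ℕ.+ 1 ⋯ m ]

  summand⁺-∷ : ∀ {s} l₀ l₁ (l : Vec ℕ s) j₀ j₁ js k m →
    summand⁺ (l₀ ∷ l₁ ∷ l) (j₀ ∷ j₁ ∷ js) k m
      ≈ e (j₁ ∸ j₀) (V (l₀ ℕ.+ j₀) (l₁ ℕ.+ j₁ ∸ 1)) * x (l₁ ℕ.+ j₁) * summand⁺ (l₁ ∷ l) (j₁ ∷ js) k m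
  summand⁺-∷ {s} l₀ l₁ l j₀ j₁ js k m
    -- In tabulated form, the factors at t + 1 for the longer vectors and at t for the shorter ones
    -- agree by computation; only associativity remains.
    rewrite range-+1 (l₀ ℕ.+ j₀) (l₁ ℕ.+ j₁ ∸ 1)
          | map-tabulate {n = s} Fin.suc (factor (l₀ ∷ l₁ ∷ l) (j₀ ∷ j₁ ∷ js))
          | map-tabulate {n = s} (λ t → t) (factor (l₁ ∷ l) (j₁ ∷ js))
    = ≈ₚ⇒≈ (⊗-assoc _ _ _)

  -- `weaklyIncreasing` branches on its first entry, which then acts as j₀ for the remaining ones.
  -- The single sum over vectors thus unfolds into the iterated one.
  ∑-summand⁺ : ∀ {s} l₀ (l : Vec ℕ s) j₀ k m →
    ∑ (map (λ js → summand⁺ (l₀ ∷ l) (j₀ ∷ js) k m) (weaklyIncreasing s j₀ k)) ≈ nested l (l₀ ℕ.+ j₀) j₀ k m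
  ∑-summand⁺ l₀ [] j₀ k m rewrite range-+1 (l₀ ℕ.+ j₀) m = ≈ₚ⇒≈ (≈-trans (⊕-comm _ _) (≈-trans (⊕-identityˡ _) (⊗-identityˡ _)))
  ∑-summand⁺ {suc s} l₀ (l₁ ∷ l) j₀ k m = begin
    ∑ (map f (List.concatMap (λ j → map (j ∷_) (weaklyIncreasing s j k)) [ j₀ ⋯ k ]))
      ≈⟨ ∑-map-concatMap f (λ j → map (j ∷_) (weaklyIncreasing s j k)) [ j₀ ⋯ k ] ⟩
    ∑ (map (λ j → ∑ (map f (map (j ∷_) (weaklyIncreasing s j k)))) [ j₀ ⋯ k ])
      ≈⟨ ∑-map-cong inner [ j₀ ⋯ k ] ⟩
    ∑ (map (λ j → g j * nested l (l₁ ℕ.+ j) j k m) [ j₀ ⋯ k ]) ∎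
    where
      f : Vec ℕ (suc s) → Carrier
      f js = summand⁺ (l₀ ∷ l₁ ∷ l) (j₀ ∷ js) k m
      g : ℕ → Carrier
      g j = e (j ∸ j₀) (V (l₀ ℕ.+ j₀) (l₁ ℕ.+ j ∸ 1)) * x (l₁ ℕ.+ j)
      inner : ∀ j → ∑ (map f (map (j ∷_) (weaklyIncreasing s j k))) ≈ g j * nested l (l₁ ℕ.+ j) j k m
      inner j = begin
        ∑ (map f (map (j ∷_) ws))
          ≡⟨ ≡.cong ∑ (map-∘ ws) ⟨
        ∑ (map (λ js → f (j ∷ js)) ws)
          ≈⟨ ∑-map-cong (λ js → summand⁺-∷ l₀ l₁ l j₀ j js k m) ws ⟩
        ∑ (map (λ js → g j * summand⁺ (l₁ ∷ l) (j ∷ js) k m) ws)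
          ≈⟨ ∑-map-*ˡ (g j) (λ js → summand⁺ (l₁ ∷ l) (j ∷ js) k m) ws ⟩
        g j * ∑ (map (λ js → summand⁺ (l₁ ∷ l) (j ∷ js) k m) ws)
          ≈⟨ *-congˡ {g j} (∑-summand⁺ l₁ l j k m) ⟩
        g j * nested l (l₁ ℕ.+ j) j k m ∎
        where ws = weaklyIncreasing s j k

  -- For s ≥ 1 the iterated sum with d₀ = j₀ = 0 has outer range 0,...,k, the form that `∑-nested`
  -- evaluates.
  e⟨⟩≈ : ∀ {s} (l : Vec ℕ s) k m → All (1 ≤_) l → Linked _<_ l → All (λ lₜ → lₜ ℕ.+ k ≤ m) l → m ≤ n ∸ 1 →
    e⟨ l ⟩ k m ≈ ∏ (map x (toList l)) * e k (V 0 m)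
  e⟨⟩≈ []           k m _ _ _ _ = trans (∑-summand⁺ 0 [] 0 k m) (sym (*-identityˡ (e k (V 0 m))))
  e⟨⟩≈ (suc q ∷ l) k m (s≤s _ ∷ _) linked bounds m≤n-1 = begin
    e⟨ suc q ∷ l ⟩ k m               ≈⟨ ∑-summand⁺ 0 (suc q ∷ l) 0 k m ⟩
    nested (suc q ∷ l) 0 0 k m       ≡⟨ ∑-range _ 0 k ⟩
    _                                ≈⟨ ∑-nested q l k m linked bounds m≤n-1 ⟩
    ∏ (map x (toList (suc q ∷ l))) * e k (V 0 m) ∎

  -- binom and [-1]^_ are taken in polyRing n; as functions of ℕ they agree with those of H* only
  -- up to induction, because the two raw semirings differ in their equality.
  binom≡ι : ∀ p k → binom p k ≡ ι (p C k)
  binom≡ι p k = ×1≡ι (p C k)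
    where
      ×1≡ι : ∀ i → i Polyₙ.× 1# ≡ ι i
      ×1≡ι zero    = ≡.refl
      ×1≡ι (suc i) = ≡.cong (1# +_) (×1≡ι i)

  [-1]^≡σ^ : ∀ z → [-1]^ z ≡ σ ^ ℤ.∣ z ∣
  [-1]^≡σ^ z = ^≡^ ℤ.∣ z ∣
    where
      ^≡^ : ∀ i → σ Polyₙ.^ i ≡ σ ^ i
      ^≡^ zero    = ≡.refl
      ^≡^ (suc i) = ≡.cong (σ *_) (^≡^ i)

  [a+r]-a≡r : ∀ a r → ℤ.+ (a ℕ.+ r) ℤ.- ℤ.+ a ≡ ℤ.+ r
  [a+r]-a≡r a r = ≡.trans (ℤₚ.[+m]-[+n]≡m⊖n (a ℕ.+ r) a)
    (≡.trans (ℤₚ.⊖-≥ (ℕₚ.m≤m+n a r)) (≡.cong ℤ.+_ (ℕₚ.m+n∸m≡n a r)))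

  [-1]^r : ∀ a r → [-1]^ (ℤ.+ (a ℕ.+ r) ℤ.- ℤ.+ a) ≡ σ ^ r
  [-1]^r a r rewrite [a+r]-a≡r a r = [-1]^≡σ^ (ℤ.+ r)

  -- For r = 0 the exponent is -1, whose absolute value is 1. For r > 0 the two exponents differ by
  -- 2.
  [-1]^[r-1] : ∀ a r → [-1]^ (ℤ.+ (a ℕ.+ r) ℤ.- ℤ.+ a ℤ.- 1ℤ) ≈ σ * σ ^ r
  [-1]^[r-1] a r rewrite [a+r]-a≡r a r | [-1]^≡σ^ (ℤ.+ r ℤ.- 1ℤ) = sign r
    where
      sign : ∀ r → σ ^ ℤ.∣ ℤ.+ r ℤ.- 1ℤ ∣ ≈ σ * σ ^ r
      sign zero    = refl {σ * 1#}
      sign (suc r) = sym (σ*σ*u≈u (σ ^ r))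

  -- The full identity, with an arbitrary factor `y` in place of x_M.

  module _ {s} (q r u : ℕ) (b≤n-1 : suc q ℕ.+ r ℕ.+ u ≤ n ∸ 1)
           (l : Vec ℕ s) (1≤l : All (1 ≤_) l) (linked : Linked _<_ l) (l<q : All (_< q) l) (y : Carrier) where
    private
      a = suc q
      c = suc q ℕ.+ r
      b = suc q ℕ.+ r ℕ.+ u
      xₗ = ∏ (map x (toList l))

      -- Here u = b - c, while `square-expansion` counts the b - c + 1 summands; hence `suc u`.
      b≡ : q ℕ.+ (r ℕ.+ suc u) ≡ b
      b≡ = ≡.trans (≡.sym (ℕₚ.+-assoc q r (suc u))) (ℕₚ.+-suc (q ℕ.+ r) u)

      i≤b : ∀ {v} → v < suc u → suc (q ℕ.+ (r ℕ.+ v)) ≤ b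
      i≤b {v} (s≤s v≤u) rewrite ≡.sym (ℕₚ.+-assoc q r v) = s≤s (ℕₚ.+-monoʳ-≤ (q ℕ.+ r) v≤u)

    coefficient : ∀ v → v < suc u →
      binom (c ℕ.+ v ∸ a) (c ∸ a) * e⟨ l ⟩ (c ℕ.+ v ∸ a ℕ.+ 1) (c ℕ.+ v ∸ 1) ≈ xₗ * coeff q r v
    coefficient v v≤u
      rewrite ℕₚ.+-assoc q r v | ℕₚ.m+n∸m≡n q (r ℕ.+ v) | ℕₚ.m+n∸m≡n q r | ℕₚ.+-comm (r ℕ.+ v) 1 | binom≡ι (r ℕ.+ v) r = begin
      ι ((r ℕ.+ v) C r) * e⟨ l ⟩ (suc (r ℕ.+ v)) (q ℕ.+ (r ℕ.+ v))
        ≈⟨ *-congˡ {ι ((r ℕ.+ v) C r)} (e⟨⟩≈ l (suc (r ℕ.+ v)) (q ℕ.+ (r ℕ.+ v)) 1≤l linked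
             -- With k = i - a + 1 and m = i - 1, the bound l_t + k ≤ m amounts to l_t < a - 1.
             (All.map (λ {lₜ} lₜ<q → ≡.subst (_≤ q ℕ.+ (r ℕ.+ v)) (≡.sym (ℕₚ.+-suc lₜ (r ℕ.+ v))) (ℕₚ.+-monoˡ-≤ (r ℕ.+ v) lₜ<q)) l<q)
             (ℕₚ.≤-trans (ℕₚ.<⇒≤ (i≤b v≤u)) b≤n-1)) ⟩
      ι ((r ℕ.+ v) C r) * (xₗ * e (suc (r ℕ.+ v)) (V 0 (q ℕ.+ (r ℕ.+ v))))
        ≈⟨ solve 3 (λ i x e → i :* (x :* e) := x :* (i :* e)) refl (ι ((r ℕ.+ v) C r)) xₗ (e (suc (r ℕ.+ v)) (V 0 (q ℕ.+ (r ℕ.+ v)))) ⟩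
      xₗ * (ι ((r ℕ.+ v) C r) * e (suc (r ℕ.+ v)) (V 0 (q ℕ.+ (r ℕ.+ v)))) ∎

    -- The two sums of the theorem differ only in the product after the coefficient, so that product
    -- is left abstract and both are treated at once.
    ∑-coefficient : ∀ (f : ℕ → Carrier) (g : ℕ → Carrier) →
      (∀ v → v < suc u → f (c ℕ.+ v) ≈ g v) →
      ∑ (map (λ i → binom (i ∸ a) (c ∸ a) * e⟨ l ⟩ (i ∸ a ℕ.+ 1) (i ∸ 1) * f i * y) [ c ⋯ b ])
        ≈ xₗ * y * ∑< (suc u) (λ v → coeff q r v * g v)
    ∑-coefficient f g f≈g = begin
      ∑ (map h [ c ⋯ b ])
        ≡⟨ ∑-range h c b ⟩
      ∑< (suc b ∸ c) (λ v → h (c ℕ.+ v))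
        ≡⟨ ≡.cong (λ t → ∑< t (λ v → h (c ℕ.+ v))) (≡.trans (ℕₚ.+-∸-assoc 1 (ℕₚ.m≤m+n c u)) (≡.cong suc (ℕₚ.m+n∸m≡n c u))) ⟩
      ∑< (suc u) (λ v → h (c ℕ.+ v))
        ≈⟨ ∑<-cong (suc u) {λ v → h (c ℕ.+ v)} {λ v → xₗ * y * (coeff q r v * g v)} term ⟩
      ∑< (suc u) (λ v → xₗ * y * (coeff q r v * g v))
        ≈⟨ ∑<-*ˡ (suc u) (xₗ * y) (λ v → coeff q r v * g v) ⟩
      xₗ * y * ∑< (suc u) (λ v → coeff q r v * g v) ∎
      where
        h k : ℕ → Carrier
        k i = binom (i ∸ a) (c ∸ a) * e⟨ l ⟩ (i ∸ a ℕ.+ 1) (i ∸ 1)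
        h i = k i * f i * y
        term : ∀ v → v < suc u → h (c ℕ.+ v) ≈ xₗ * y * (coeff q r v * g v)
        term v v≤u = begin
          k (c ℕ.+ v) * f (c ℕ.+ v) * y
            ≈⟨ *-congʳ {y} (*-cong {k (c ℕ.+ v)} {xₗ * coeff q r v} (coefficient v v≤u) (f≈g v v≤u)) ⟩
          xₗ * coeff q r v * g v * y
            ≈⟨ solve 4 (λ x c g y → x :* c :* g :* y := x :* y :* (c :* g)) refl xₗ (coeff q r v) (g v) y ⟩
          xₗ * y * (coeff q r v * g v) ∎

    expansion :
      xₗ * ∏ x[ a ⋯ c ∸ 1 ] * (x c * x c) * ∏ x[ c ℕ.+ 1 ⋯ b ] * y
        ≈ [-1]^ (ℤ.+ c ℤ.- ℤ.+ a ℤ.- 1ℤ)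
            * ∑ (map (λ i → binom (i ∸ a) (c ∸ a) * e⟨ l ⟩ (i ∸ a ℕ.+ 1) (i ∸ 1) * ∏ x[ i ⋯ b ] * y) [ c ⋯ b ])
        + [-1]^ (ℤ.+ c ℤ.- ℤ.+ a)
            * ∑ (map (λ i → binom (i ∸ a) (c ∸ a) * e⟨ l ⟩ (i ∸ a ℕ.+ 1) (i ∸ 1) * ∏ x[ i ℕ.+ 1 ⋯ b ℕ.+ 1 ] * y) [ c ⋯ b ])
        + xₗ * ∏ x[ a ⋯ b ℕ.+ 1 ] * y
    expansion = begin
      xₗ * ∏ (V q (q ℕ.+ r)) * (x c * x c) * ∏ x[ c ℕ.+ 1 ⋯ b ] * y
        ≡⟨ ≡.cong (λ ys → xₗ * ∏ (V q (q ℕ.+ r)) * (x c * x c) * ∏ ys * y) (range-+1 c b) ⟩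
      xₗ * ∏ (V q (q ℕ.+ r)) * (x c * x c) * ∏ (V c b) * y
        -- One factor x_c completes the run x_a⋯x_b; the other is the extra variable of
        -- `square-expansion`.
        ≈⟨ solve 5 (λ w p c t y → w :* p :* (c :* c) :* t :* y := w :* y :* (p :* (c :* t) :* c)) refl
             xₗ (∏ (V q (q ℕ.+ r))) (x c) (∏ (V c b)) y ⟩
      W * (∏ (V q (q ℕ.+ r)) * (x c * ∏ (V c b)) * x c)
        ≈⟨ *-congˡ {W} (*-congʳ {x c} whole) ⟨
      W * (∏ (V q b) * x c)
        ≈⟨ *-congˡ {W} (square-expansion q r (suc u) b b≡ b≤n-1) ⟩
      W * (σ * σ ^ r * Y q r b (suc u) + σ ^ r * (Z q r b (suc u) * x (suc b)) + ∏ (V q b) * x (suc b))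
        ≈⟨ solve 7 (λ w y s t Y Z P → w :* y :* (s :* Y :+ t :* Z :+ P) := s :* (w :* y :* Y) :+ t :* (w :* y :* Z) :+ w :* P :* y)
             refl xₗ y (σ * σ ^ r) (σ ^ r) (Y q r b (suc u)) (Z q r b (suc u) * x (suc b)) (∏ (V q b) * x (suc b)) ⟩
      σ * σ ^ r * (W * Y q r b (suc u)) + σ ^ r * (W * (Z q r b (suc u) * x (suc b))) + xₗ * (∏ (V q b) * x (suc b)) * y
        ≈⟨ +-cong (+-cong (*-cong ([-1]^[r-1] a r) first) (*-cong (reflexive ([-1]^r a r)) second)) third ⟨
      _ ∎
      where
        W = xₗ * y

        whole : ∏ (V q b) ≈ ∏ (V q (q ℕ.+ r)) * (x c * ∏ (V c b))
        whole = begin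
          ∏ (V q b)
            ≡⟨ ≡.cong (λ m → ∏ (V q m)) (ℕₚ.+-suc (q ℕ.+ r) u) ⟨
          ∏ (V q (q ℕ.+ r ℕ.+ suc u))
            ≈⟨ ∏-split (suc u) (ℕₚ.m≤m+n q r) ⟩
          ∏ (V q (q ℕ.+ r)) * ∏ (V (q ℕ.+ r) (q ℕ.+ r ℕ.+ suc u))
            ≡⟨ ≡.cong (λ m → ∏ (V q (q ℕ.+ r)) * ∏ (V (q ℕ.+ r) m)) (ℕₚ.+-suc (q ℕ.+ r) u) ⟩
          ∏ (V q (q ℕ.+ r)) * ∏ (V (q ℕ.+ r) b)
            ≈⟨ *-congˡ {∏ (V q (q ℕ.+ r))} (∏-first (s≤s (ℕₚ.m≤m+n (q ℕ.+ r) u))) ⟩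
          ∏ (V q (q ℕ.+ r)) * (x c * ∏ (V c b)) ∎

        first : ∑ (map (λ i → binom (i ∸ a) (c ∸ a) * e⟨ l ⟩ (i ∸ a ℕ.+ 1) (i ∸ 1) * ∏ x[ i ⋯ b ] * y) [ c ⋯ b ])
                ≈ W * Y q r b (suc u)
        first = ∑-coefficient (λ i → ∏ x[ i ⋯ b ]) (λ v → ∏ (V (q ℕ.+ (r ℕ.+ v)) b))
          (λ v _ → reflexive (≡.cong (λ d → ∏ (V d b)) (ℕₚ.+-assoc q r v)))

        second : ∑ (map (λ i → binom (i ∸ a) (c ∸ a) * e⟨ l ⟩ (i ∸ a ℕ.+ 1) (i ∸ 1) * ∏ x[ i ℕ.+ 1 ⋯ b ℕ.+ 1 ] * y) [ c ⋯ b ])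
                 ≈ W * (Z q r b (suc u) * x (suc b))
        second = begin
          -- Every product here ends in x_{b+1}, including the one for i = b, so x_{b+1} can be
          -- taken out to leave `Z`.
          _ ≈⟨ ∑-coefficient (λ i → ∏ x[ i ℕ.+ 1 ⋯ b ℕ.+ 1 ]) (λ v → ∏ (V (suc (q ℕ.+ (r ℕ.+ v))) b) * x (suc b)) last ⟩
          W * ∑< (suc u) (λ v → coeff q r v * (∏ (V (suc (q ℕ.+ (r ℕ.+ v))) b) * x (suc b)))
            ≈⟨ *-congˡ {W} (∑<-cong (suc u)
                 {λ v → coeff q r v * (∏ (V (suc (q ℕ.+ (r ℕ.+ v))) b) * x (suc b))}
                 {λ v → x (suc b) * (coeff q r v * ∏ (V (suc (q ℕ.+ (r ℕ.+ v))) b))}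
                 (λ v _ → solve 3 (λ k p t → k :* (p :* t) := t :* (k :* p)) refl
                    (coeff q r v) (∏ (V (suc (q ℕ.+ (r ℕ.+ v))) b)) (x (suc b)))) ⟩
          W * ∑< (suc u) (λ v → x (suc b) * (coeff q r v * ∏ (V (suc (q ℕ.+ (r ℕ.+ v))) b)))
            ≈⟨ *-congˡ {W} (∑<-*ˡ (suc u) (x (suc b)) (λ v → coeff q r v * ∏ (V (suc (q ℕ.+ (r ℕ.+ v))) b))) ⟩
          W * (x (suc b) * Z q r b (suc u))
            ≈⟨ *-congˡ {W} (*-comm (x (suc b)) (Z q r b (suc u))) ⟩
          W * (Z q r b (suc u) * x (suc b)) ∎
          where
            last : ∀ v → v < suc u → ∏ x[ c ℕ.+ v ℕ.+ 1 ⋯ b ℕ.+ 1 ] ≈ ∏ (V (suc (q ℕ.+ (r ℕ.+ v))) b) * x (suc b)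
            last v v≤u rewrite range-+1 (c ℕ.+ v) (b ℕ.+ 1) | ℕₚ.+-assoc q r v | ℕₚ.+-comm (q ℕ.+ r ℕ.+ u) 1 = ∏-last (i≤b v≤u)

        third : xₗ * ∏ x[ a ⋯ b ℕ.+ 1 ] * y ≈ xₗ * (∏ (V q b) * x (suc b)) * y
        third = *-congʳ {y} (*-congˡ {xₗ} (trans (reflexive (≡.cong (λ m → ∏ (V q m)) (ℕₚ.+-comm b 1)))
          (∏-last {q} {b} (ℕₚ.≤-trans (ℕₚ.m≤m+n q (r ℕ.+ suc u)) (ℕₚ.≤-reflexive b≡)))))

theorem4p4 :
    ∀ (n : ℕ) → 1 ≤ n →
    ∀ (s a c b : ℕ) → 1 ≤ a → a ≤ c → c ≤ b → b ≤ n ∸ 1 →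
    ∀ (l : Vec ℕ s) → All (1 ≤_) l → Linked _<_ l → All (_< a ∸ 1) l →
    ∀ (M : Subset n) → (∀ {j} → j ∈ M → b ℕ.+ 2 ≤ toℕ j) →
    let open Peterson n
        open CommutativeRing H*
        xₗ = ∏ (map x (toList l))
    in
    xₗ * ∏ x[ a ⋯ c ∸ 1 ] * (x c * x c) * ∏ x[ c ℕ.+ 1 ⋯ b ] * x-set M
      ≈ [-1]^ (ℤ.+ c ℤ.- ℤ.+ a ℤ.- 1ℤ)
          * ∑ (map (λ i → binom (i ∸ a) (c ∸ a) * e⟨ l ⟩ (i ∸ a ℕ.+ 1) (i ∸ 1)
                            * ∏ x[ i ⋯ b ] * x-set M)
                   [ c ⋯ b ])
      + [-1]^ (ℤ.+ c ℤ.- ℤ.+ a)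
          * ∑ (map (λ i → binom (i ∸ a) (c ∸ a) * e⟨ l ⟩ (i ∸ a ℕ.+ 1) (i ∸ 1)
                            * ∏ x[ i ℕ.+ 1 ⋯ b ℕ.+ 1 ] * x-set M)
                   [ c ⋯ b ])
      + xₗ * ∏ x[ a ⋯ b ℕ.+ 1 ] * x-set M
theorem4p4 n _ s (suc q) c b (s≤s _) a≤c c≤b b≤n-1 l 1≤l linked l<q M _
  -- Replacing the inequalities by c = a + r and b = c + u lets the truncated and integer
  -- subtractions of the statement cancel.
  with ℕₚ.m≤n⇒∃[o]m+o≡n a≤c | ℕₚ.m≤n⇒∃[o]m+o≡n c≤b
... | r , ≡.refl | u , ≡.refl = Cohomology.expansion n q r u b≤n-1 l 1≤l linked l<q (Peterson.x-set n M)
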